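{- Let $d\ge 8$ and $n\ge 1$. Let $B^0,\dots,B^{n-1}$ be $n$ vertex-disjoint copies of $K_{d-2}$, the vertices of $B^i$ being labelled $a^i_1,\dots,a^i_{d-2}$, and connect consecutive bays by making $a^i_j$ adjacent to $a^{i-1}_{d-1-j}$ for all $0\le i\le n-1$ and $1\le j\le\lceil (d-2)/2\rceil$, superscripts taken mod $n$. Let $P^5_d$ be the graph obtained from $K_{d+1}$ by deleting the edges of two paths of length 2 and a 3-cycle (pairwise vertex-disjoint) and then deleting a maximum matching on the $d-8$ remaining vertices; its vertices of degree $d-2$ are the two middle vertices of the paths and the three vertices of the 3-cycle. Let $H^5_d$ be obtained by adding pairwise vertex-disjoint copies of $P^5_d$, where for each copy one edge is added from each of its five vertices of degree $d-2$ to a vertex of a single bay $B^i$ (the same bay for all five edges), there are no edges between distinct copies, and enough copies are added so that every vertex of every $B^i$ has degree at least $d-1$. Then $H^5_d$ has minimum degree $d-1$ and has no immersion of $K_d$.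
   Context: All graphs are simple. A graph $H$ is immersed in a graph $G$ if there is an injection $\phi:V(H)\to V(G)$ and an assignment to each edge $uv\in E(H)$ of a path in $G$ between $\phi(u)$ and $\phi(v)$ with paths of distinct edges pairwise edge-disjoint. -}

module Defs where

open import Data.Bool using (Bool; true; false; not; _∧_; _∨_)
open import Data.Nat using (ℕ; zero; suc; _+_; _*_; _∸_; _≤ᵇ_; _≡ᵇ_; _%_; ⌈_/2⌉)
open import Data.Fin using (Fin; toℕ; _<_)
open import Data.Product using (_×_; _,_)
open import Data.Sum using (_⊎_; inj₁; inj₂)
open import Data.List using (List; []; _∷_; length; filterᵇ; map; _++_; allFin; cartesianProduct)
open import Data.List.Membership.Propositional using (_∈_)
open import Data.List.Relation.Unary.Unique.Propositional using (Unique)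
open import Relation.Binary.PropositionalEquality using (_≡_)
open import Relation.Nullary using (¬_)

module GraphNotions {V : Set} (adj : V → V → Bool) where

  Adj : V → V → Set
  Adj u v = adj u v ≡ true

  data Walk : V → V → Set where
    []  : ∀ {x} → Walk x x
    _∷_ : ∀ {x y z} → Adj x y → Walk y z → Walk x z

  verts : ∀ {x y} → Walk x y → List V
  verts {x} []      = x ∷ []
  verts {x} (_ ∷ w) = x ∷ verts w

  edges : ∀ {x y} → Walk x y → List (V × V)
  edges []                  = []
  edges {x} (_∷_ {y = y} _ w) = (x , y) ∷ edges w

  IsPath : ∀ {x y} → Walk x y → Set
  IsPath w = Unique (verts w)

  SameEdge : V × V → V × V → Set
  SameEdge (a , b) (c , d) = (a ≡ c × b ≡ d) ⊎ (a ≡ d × b ≡ c)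

  EdgeDisjoint : ∀ {x y x' y'} → Walk x y → Walk x' y' → Set
  EdgeDisjoint w w' = ∀ e e' → e ∈ edges w → e' ∈ edges w' → ¬ SameEdge e e'

  record ImmersionK (d : ℕ) : Set where
    field
      φ          : Fin d → V
      φ-inj      : ∀ i j → φ i ≡ φ j → i ≡ j
      route      : ∀ i j → i < j → Walk (φ i) (φ j)
      route-path : ∀ i j (p : i < j) → IsPath (route i j p)
      disjoint   : ∀ i j i' j' (p : i < j) (p' : i' < j') →
                   ¬ (i ≡ i' × j ≡ j') → EdgeDisjoint (route i j p) (route i' j' p')

  -- degree, w.r.t. a list enumerating all vertices exactly once
  degree : List V → V → ℕ
  degree allV v = length (filterᵇ (adj v) allV)

-- The graph P^5_d on vertex set {0,…,d} (as Fin (suc d)):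
-- K_{d+1} minus the paths 0-1-2 and 3-4-5, the triangle 6-7-8, and the
-- maximum matching {9,10},{11,12},… on the remaining vertices 9,…,d.

finEqᵇ : ∀ {k} → Fin k → Fin k → Bool
finEqᵇ a b = toℕ a ≡ᵇ toℕ b

pairIs : ℕ → ℕ → ℕ → ℕ → Bool
pairIs a b x y = (a ≡ᵇ x) ∧ (b ≡ᵇ y)

removedℕ : ℕ → ℕ → Bool
removedℕ a b =
  pairIs a b 0 1 ∨ pairIs a b 1 2 ∨ pairIs a b 3 4 ∨ pairIs a b 4 5 ∨
  pairIs a b 6 7 ∨ pairIs a b 7 8 ∨ pairIs a b 6 8 ∨
  ((9 ≤ᵇ a) ∧ (a % 2 ≡ᵇ 1) ∧ (b ≡ᵇ suc a))

P5adj : (d : ℕ) → Fin (suc d) → Fin (suc d) → Bool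
P5adj d x y = not (finEqᵇ x y) ∧ not (removedℕ (toℕ x) (toℕ y) ∨ removedℕ (toℕ y) (toℕ x))

-- the five vertices of degree d-2 of P^5_d: 1, 4 (path middles), 6, 7, 8 (triangle)
specialℕ : Fin 5 → ℕ
specialℕ k = lookup5 (toℕ k)
  where
  lookup5 : ℕ → ℕ
  lookup5 0 = 1
  lookup5 1 = 4
  lookup5 2 = 6
  lookup5 3 = 7
  lookup5 _ = 8

-- Bays: B^i = K_{d-2} on vertices (i , p), p : Fin (d-2), where (i , p)
-- stands for a^i_{p+1}.  a^i_j ~ a^{i-1}_{d-1-j} for 1 ≤ j ≤ ⌈(d-2)/2⌉,
-- superscripts mod n.

BayV : ℕ → ℕ → Set
BayV d n = Fin n × Fin (d ∸ 2)

isPredMod : ∀ {n} → Fin n → Fin n → Bool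
isPredMod {n} i i' = (suc (toℕ i') ≡ᵇ toℕ i) ∨ ((toℕ i ≡ᵇ 0) ∧ (suc (toℕ i') ≡ᵇ n))

-- link (i , p) (i' , p') : a^i_j with j = p+1 is joined to a^{i-1}_{d-1-j}
link : (d n : ℕ) → BayV d n → BayV d n → Bool
link d n (i , p) (i' , p') =
  isPredMod i i' ∧ (suc (toℕ p) ≤ᵇ ⌈ d ∸ 2 /2⌉) ∧ (suc (toℕ p') + suc (toℕ p) ≡ᵇ d ∸ 1)

bayAdj : (d n : ℕ) → BayV d n → BayV d n → Bool
bayAdj d n (i , p) (i' , p') =
  not (finEqᵇ i i' ∧ finEqᵇ p p') ∧
  (finEqᵇ i i' ∨ link d n (i , p) (i' , p') ∨ link d n (i' , p') (i , p))

-- H^5_d: bays together with m copies of P^5_d. Copy c is attached to the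
-- bay β c; its special vertex number k (k : Fin 5) gets one edge to the
-- bay vertex (β c , t c k).

HV : (d n m : ℕ) → Set
HV d n m = BayV d n ⊎ (Fin m × Fin (suc d))

attach : (d n m : ℕ) (β : Fin m → Fin n) (t : Fin m → Fin 5 → Fin (d ∸ 2)) →
         BayV d n → Fin m × Fin (suc d) → Bool
attach d n m β t (i , p) (c , x) =
  finEqᵇ (β c) i ∧ anyFin5 (λ k → (toℕ x ≡ᵇ specialℕ k) ∧ finEqᵇ (t c k) p)
  where
  anyFin5 : (Fin 5 → Bool) → Bool
  anyFin5 f = f Fin.zero ∨ f (Fin.suc Fin.zero) ∨ f (Fin.suc (Fin.suc Fin.zero)) ∨
              f (Fin.suc (Fin.suc (Fin.suc Fin.zero))) ∨
              f (Fin.suc (Fin.suc (Fin.suc (Fin.suc Fin.zero))))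
    where import Data.Fin as Fin

Hadj : (d n m : ℕ) (β : Fin m → Fin n) (t : Fin m → Fin 5 → Fin (d ∸ 2)) →
       HV d n m → HV d n m → Bool
Hadj d n m β t (inj₁ a) (inj₁ b) = bayAdj d n a b
Hadj d n m β t (inj₂ (c , x)) (inj₂ (c' , y)) = finEqᵇ c c' ∧ P5adj d x y
Hadj d n m β t (inj₁ a) (inj₂ u) = attach d n m β t a u
Hadj d n m β t (inj₂ u) (inj₁ a) = attach d n m β t a u

allHV : (d n m : ℕ) → List (HV d n m)
allHV d n m = map inj₁ (cartesianProduct (allFin n) (allFin (d ∸ 2))) ++
              map inj₂ (cartesianProduct (allFin m) (allFin (suc d)))

Hdeg : (d n m : ℕ) (β : Fin m → Fin n) (t : Fin m → Fin 5 → Fin (d ∸ 2)) → HV d n m → ℕ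
Hdeg d n m β t = GraphNotions.degree (Hadj d n m β t) (allHV d n m)

HImmersesK : (d n m : ℕ) (β : Fin m → Fin n) (t : Fin m → Fin 5 → Fin (d ∸ 2)) → ℕ → Set
HImmersesK d n m β t k = GraphNotions.ImmersionK (Hadj d n m β t) k

{-# OPTIONS --safe #-}
-- Across an edge cut with a branch vertices on one side and d - a on the other run at least
-- a (d - a) routes. The five edges leaving a copy of P⁵ therefore cannot separate two branch
-- vertices, and an interval of bays, having at most 2⌈(d-2)/2⌉ ≤ d - 1 boundary edges, cannot have
-- two branch vertices inside and two outside. The latter excludes that all branch vertices lie in
-- bays, since a bay has only d - 2 vertices. Suppose then that all lie in one copy, which has a
-- single further vertex w. By a degree count no route passes through a branch vertex, so the routes
-- replacing removed edges run through w or outside the copy. Each of the two removed paths avoiding w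
-- makes one of its routes use the edge from w to the bays; if both paths avoid w this is a clash.
-- Otherwise w lies on one path, is its middle because it has an edge to the bays, and leaves that
-- edge unavailable to the removed triangle, whose three routes would then have to alternate between
-- "through w" and "outside".
module Submission where

open import Defs
open import Data.Bool using (Bool; true; false; not; _∧_; _∨_; if_then_else_)
open import Data.Bool.Properties using (T-≡; ∧-conicalˡ; ∧-conicalʳ; ∨-comm)
open import Data.Nat as ℕ using (ℕ; zero; suc; _≤_; _∸_; s≤s; z≤n; _+_; _≡ᵇ_; ⌈_/2⌉; ⌊_/2⌋; _%_)
import Data.Nat.Properties as ℕₚ
open import Data.Fin as Fin using (Fin; zero; suc; toℕ; _<_; punchIn; punchOut; #_)
import Data.Fin.Properties as Finₚ
open import Data.Sum using (_⊎_; inj₁; inj₂; [_,_]′)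
open import Data.Product using (_×_; _,_; ∃; ∃₂; proj₁; proj₂; uncurry)
open import Data.Empty using (⊥; ⊥-elim)
open import Data.List using (List; []; _∷_; filterᵇ; lookup)
open import Data.List.Membership.Propositional using (_∈_)
open import Data.List.Membership.Propositional.Properties
  using (∈-map⁺; ∈-map⁻; ∈-++⁺ˡ; ∈-++⁺ʳ; ∈-cartesianProduct⁺; ∈-allFin; ∈-filter⁺; ∈-filter⁻; ∈-lookup)
open import Data.List.Relation.Unary.Any using (here; there; index)
open import Data.List.Relation.Unary.Any.Properties using (lookup-index)
open import Data.List.Relation.Unary.All as All using ()
open import Data.List.Relation.Unary.AllPairs using (_∷_)
open import Data.List.Relation.Unary.Unique.Propositional using (Unique)
import Data.List.Relation.Unary.Unique.Propositional.Properties as Uniqueₚ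
open import Function using (_∘_)
open import Function.Bundles using (Equivalence)
open import Relation.Unary using (Decidable)
open import Relation.Binary.Definitions using (tri<; tri≈; tri>)
open import Relation.Binary.PropositionalEquality
  using (_≡_; _≢_; refl; sym; trans; cong; cong₂; subst; subst₂; ≢-sym)
open import Relation.Nullary using (¬_; Dec; yes; no; contradiction; ¬?; _×-dec_)
open import Relation.Nullary.Decidable using (T?; False; toWitnessFalse; decidable-stable)

-- Walks, paths and the edges on them.

module _ {V : Set} (adj : V → V → Bool) where
  open GraphNotions adj

  edge-adj : ∀ {x y u v} (w : Walk x y) → (u , v) ∈ edges w → Adj u v
  edge-adj (e ∷ w) (here refl) = e
  edge-adj (e ∷ w) (there m)   = edge-adj w m

  source∈verts : ∀ {x y} (w : Walk x y) → x ∈ verts w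
  source∈verts []      = here refl
  source∈verts (_ ∷ w) = here refl

  tail∈verts : ∀ {x y u v} (w : Walk x y) → (u , v) ∈ edges w → u ∈ verts w
  tail∈verts (e ∷ w) (here refl) = here refl
  tail∈verts (e ∷ w) (there m)   = there (tail∈verts w m)

  head∈verts : ∀ {x y u v} (w : Walk x y) → (u , v) ∈ edges w → v ∈ verts w
  head∈verts (e ∷ w) (here refl) = there (source∈verts w)
  head∈verts (e ∷ w) (there m)   = there (head∈verts w m)

  first-edge : ∀ {x y} (w : Walk x y) → x ≢ y → ∃ λ v → (x , v) ∈ edges w
  first-edge []      x≢y = contradiction refl x≢y
  first-edge (e ∷ w) _   = _ , here refl

  last-edge : ∀ {x y} (w : Walk x y) → x ≡ y ⊎ ∃ λ v → (v , y) ∈ edges w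
  last-edge []      = inj₁ refl
  last-edge (e ∷ w) with last-edge w
  ... | inj₁ refl    = inj₂ (_ , here refl)
  ... | inj₂ (v , m) = inj₂ (v , there m)

  -- The path does not turn back: a return to `u` would repeat a vertex.
  next-edge : ∀ {x y u v} (w : Walk x y) → IsPath w → (u , v) ∈ edges w → v ≢ y →
              ∃ λ v' → v' ≢ u × (v , v') ∈ edges w
  next-edge (e ∷ [])       _          (here refl) v≢y = contradiction refl v≢y
  next-edge (e ∷ (e' ∷ w)) (x∉ ∷ _)   (here refl) _   =
    _ , ≢-sym (All.lookup x∉ (there (source∈verts w))) , there (here refl)
  next-edge (e ∷ w)        (_ ∷ path) (there m)   v≢y with next-edge w path m v≢y
  ... | v' , v'≢u , m' = v' , v'≢u , there m'

  previous-edge : ∀ {x y u v} (w : Walk x y) → IsPath w → (v , u) ∈ edges w →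
                  v ≡ x ⊎ ∃ λ v' → v' ≢ u × (v' , v) ∈ edges w
  previous-edge (e ∷ w) _           (here refl) = inj₁ refl
  previous-edge (e ∷ w) (x∉ ∷ path) (there m) with previous-edge w path m
  ... | inj₁ refl             = inj₂ (_ , All.lookup x∉ (head∈verts w m) , here refl)
  ... | inj₂ (v' , v'≢u , m') = inj₂ (v' , v'≢u , there m')

  crossing-edge : ∀ {S : V → Set} → Decidable S → ∀ {x y} (w : Walk x y) → S x → ¬ S y →
                  ∃₂ λ u v → S u × ¬ S v × (u , v) ∈ edges w
  crossing-edge S? []                  Sx ¬Sy = contradiction Sx ¬Sy
  crossing-edge S? (_∷_ {y = z} e w) Sx ¬Sy with S? z
  ... | no ¬Sz = _ , _ , Sx , ¬Sz , here refl
  ... | yes Sz with crossing-edge S? w Sz ¬Sy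
  ...   | u , v , Su , ¬Sv , m = u , v , Su , ¬Sv , there m

  Traverses : ∀ {x y} → Walk x y → V → V → Set
  Traverses w u v = (u , v) ∈ edges w ⊎ (v , u) ∈ edges w

  traverses-flip : ∀ {x y u v} (w : Walk x y) → Traverses w u v → Traverses w v u
  traverses-flip _ (inj₁ m) = inj₂ m
  traverses-flip _ (inj₂ m) = inj₁ m

  traverses-continue : ∀ {x y u v} (w : Walk x y) → IsPath w → Traverses w u v → v ≢ x → v ≢ y →
                       ∃ λ v' → v' ≢ u × Traverses w v v'
  traverses-continue w path (inj₁ m) v≢x v≢y with next-edge w path m v≢y
  ... | v' , v'≢u , m' = v' , v'≢u , inj₁ m'
  traverses-continue w path (inj₂ m) v≢x v≢y with previous-edge w path m
  ... | inj₁ v≡x              = contradiction v≡x v≢x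
  ... | inj₂ (v' , v'≢u , m') = v' , v'≢u , inj₂ m'

-- Routes of an immersion as unordered objects.

SamePair : {A : Set} → A → A → A → A → Set
SamePair i j i' j' = (i ≡ i' × j ≡ j') ⊎ (i ≡ j' × j ≡ i')

module Immersed {V : Set} (adj : V → V → Bool)
                (adj-sym : ∀ {u v} → adj u v ≡ true → adj v u ≡ true)
                {d : ℕ} (imm : GraphNotions.ImmersionK adj d) where
  open GraphNotions adj
  open ImmersionK imm public

  -- Routes exist only for `i < j` and walk edges are directed. `Uses` forgets both orientations, so
  -- that every edge has a well-defined unordered pair of ends.
  Uses : Fin d → Fin d → V → V → Set
  Uses i j u v = (∃ λ (p : i < j) → Traverses adj (route i j p) u v) ⊎
                 (∃ λ (p : j < i) → Traverses adj (route j i p) u v)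

  uses-swap : ∀ {i j u v} → Uses i j u v → Uses j i u v
  uses-swap (inj₁ x) = inj₂ x
  uses-swap (inj₂ x) = inj₁ x

  uses-flip : ∀ {i j u v} → Uses i j u v → Uses i j v u
  uses-flip (inj₁ (p , m)) = inj₁ (p , traverses-flip adj (route _ _ p) m)
  uses-flip (inj₂ (p , m)) = inj₂ (p , traverses-flip adj (route _ _ p) m)

  traverses-adj : ∀ {x y u v} (w : Walk x y) → Traverses adj w u v → Adj u v
  traverses-adj w (inj₁ m) = edge-adj adj w m
  traverses-adj w (inj₂ m) = adj-sym (edge-adj adj w m)

  uses-adj : ∀ {i j u v} → Uses i j u v → Adj u v
  uses-adj (inj₁ (p , m)) = traverses-adj (route _ _ p) m
  uses-adj (inj₂ (p , m)) = traverses-adj (route _ _ p) m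

  uses-start : ∀ {i j} → i ≢ j → ∃ λ v → Uses i j (φ i) v
  uses-start {i} {j} i≢j with Finₚ.<-cmp i j
  ... | tri≈ _ i≡j _ = contradiction i≡j i≢j
  ... | tri< p _ _ with first-edge adj (route i j p) (i≢j ∘ φ-inj i j)
  ...   | v , m = v , inj₁ (p , inj₁ m)
  uses-start {i} {j} i≢j | tri> _ _ p with last-edge adj (route j i p)
  ... | inj₁ e       = contradiction (sym (φ-inj j i e)) i≢j
  ... | inj₂ (v , m) = v , inj₂ (p , inj₂ m)

  uses-continue : ∀ {i j u v} → Uses i j u v → v ≢ φ i → v ≢ φ j →
                  ∃ λ v' → v' ≢ u × Uses i j v v'
  uses-continue (inj₁ (p , m)) v≢i v≢j
    with traverses-continue adj (route _ _ p) (route-path _ _ p) m v≢i v≢j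
  ... | v' , v'≢u , m' = v' , v'≢u , inj₁ (p , m')
  uses-continue (inj₂ (p , m)) v≢i v≢j
    with traverses-continue adj (route _ _ p) (route-path _ _ p) m v≢j v≢i
  ... | v' , v'≢u , m' = v' , v'≢u , inj₂ (p , m')

  route-unique : ∀ {i j i' j'} (p : i < j) (p' : i' < j') {u v} →
                 Traverses adj (route i j p) u v → Traverses adj (route i' j' p') u v →
                 i ≡ i' × j ≡ j'
  route-unique {i} {j} {i'} {j'} p p' m m' =
    decidable-stable ((i Fin.≟ i') ×-dec (j Fin.≟ j')) λ ne → clash (disjoint i j i' j' p p' ne) m m'
    where
    clash : ∀ {u v} → EdgeDisjoint (route i j p) (route i' j' p') →
            Traverses adj (route i j p) u v → ¬ Traverses adj (route i' j' p') u v
    clash dis (inj₁ m) (inj₁ m') = dis _ _ m m' (inj₁ (refl , refl))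
    clash dis (inj₁ m) (inj₂ m') = dis _ _ m m' (inj₂ (refl , refl))
    clash dis (inj₂ m) (inj₁ m') = dis _ _ m m' (inj₂ (refl , refl))
    clash dis (inj₂ m) (inj₂ m') = dis _ _ m m' (inj₁ (refl , refl))

  uses-unique : ∀ {i j i' j' u v} → Uses i j u v → Uses i' j' u v → SamePair i j i' j'
  uses-unique (inj₁ (p , m)) (inj₁ (p' , m')) = inj₁ (route-unique p p' m m')
  uses-unique (inj₁ (p , m)) (inj₂ (p' , m')) = inj₂ (route-unique p p' m m')
  uses-unique (inj₂ (p , m)) (inj₁ (p' , m')) with route-unique p p' m m'
  ... | a , b = inj₂ (b , a)
  uses-unique (inj₂ (p , m)) (inj₂ (p' , m')) with route-unique p p' m m'
  ... | a , b = inj₁ (b , a)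

  uses-cross : ∀ {S : V → Set} → Decidable S → ∀ {i j} → S (φ i) → ¬ S (φ j) →
               ∃₂ λ u v → S u × ¬ S v × Uses i j u v
  uses-cross {S} S? {i} {j} Si ¬Sj with Finₚ.<-cmp i j
  ... | tri≈ _ refl _ = contradiction Si ¬Sj
  ... | tri< p _ _ with crossing-edge adj S? (route i j p) Si ¬Sj
  ...   | u , v , Su , ¬Sv , m = u , v , Su , ¬Sv , inj₁ (p , inj₁ m)
  uses-cross {S} S? {i} {j} Si ¬Sj | tri> _ _ p
    -- This route starts outside `S`, so the crossing is sought for the complement and then
    -- reversed.
    with crossing-edge adj (¬? ∘ S?) (route j i p) ¬Sj (contradiction Si)
  ... | u , v , ¬Su , ¬¬Sv , m =
    v , u , decidable-stable (S? v) ¬¬Sv , ¬Su , inj₂ (p , inj₂ m)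

  -- A branch vertex spends d - 1 edges on the routes ending there, and a route passing through it would need two more.
  branch-not-interior : ∀ i (code : ∀ v → Adj (φ i) v → Fin d) →
    (∀ {u v} a b → code u a ≡ code v b → u ≡ v) →
    ∀ {p q u} → Uses p q u (φ i) → i ≡ p ⊎ i ≡ q
  branch-not-interior i code code-inj {p} {q} {u} m with i Fin.≟ p | i Fin.≟ q
  ... | yes i≡p | _       = inj₁ i≡p
  ... | no _    | yes i≡q = inj₂ i≡q
  ... | no i≢p  | no i≢q
    with uses-continue m (i≢p ∘ φ-inj i p) (i≢q ∘ φ-inj i q)
  ... | v , v≢u , m' = ⊥-elim (clash (Finₚ.pigeonhole (ℕₚ.n<1+n d) enc))
    where
    -- No route joins `i` to itself, so slot `i` is free for `v`, by which the passing route leaves.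
    -- With `u` these are d + 1 distinct neighbours, but only d codes exist.
    spoke : Fin d → ∃ (Adj (φ i))
    spoke j with i Fin.≟ j
    ... | yes _  = v , uses-adj m'
    ... | no i≢j = proj₁ (uses-start i≢j) , uses-adj (proj₂ (uses-start i≢j))
    spoke≢u : ∀ j → u ≢ proj₁ (spoke j)
    spoke≢u j e with i Fin.≟ j
    ... | yes _ = v≢u (sym e)
    ... | no i≢j with uses-unique (uses-flip m) (subst (Uses i j (φ i)) (sym e) (proj₂ (uses-start i≢j)))
    ...   | inj₁ (p≡i , _) = i≢p (sym p≡i)
    ...   | inj₂ (_ , q≡i) = i≢q (sym q≡i)
    start≢v : ∀ {j} (i≢j : i ≢ j) → v ≢ proj₁ (uses-start i≢j)
    start≢v {j} i≢j e with uses-unique m' (subst (Uses i j (φ i)) (sym e) (proj₂ (uses-start i≢j)))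
    ... | inj₁ (p≡i , _) = i≢p (sym p≡i)
    ... | inj₂ (_ , q≡i) = i≢q (sym q≡i)
    spoke-inj : ∀ j k → proj₁ (spoke j) ≡ proj₁ (spoke k) → j ≡ k
    spoke-inj j k e with i Fin.≟ j | i Fin.≟ k
    ... | yes i≡j | yes i≡k = trans (sym i≡j) i≡k
    ... | yes _   | no i≢k  = contradiction e (start≢v i≢k)
    ... | no i≢j  | yes _   = contradiction (sym e) (start≢v i≢j)
    ... | no i≢j  | no i≢k
      with uses-unique (proj₂ (uses-start i≢j)) (subst (Uses i k (φ i)) (sym e) (proj₂ (uses-start i≢k)))
    ...   | inj₁ (_ , j≡k)   = j≡k
    ...   | inj₂ (i≡k , _)   = contradiction i≡k i≢k
    enc : Fin (suc d) → Fin d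
    enc zero    = code u (uses-adj (uses-flip m))
    enc (suc j) = uncurry code (spoke j)
    clash : (∃₂ λ a b → a < b × enc a ≡ enc b) → ⊥
    clash (zero  , suc b , _ , e) = spoke≢u b (code-inj _ _ e)
    clash (suc a , suc b , s≤s a<b , e) =
      ℕₚ.<⇒≢ a<b (cong toℕ (spoke-inj a b (code-inj _ _ e)))

  -- `Code k u v` says that the label `k` names the edge from `u` out of `S`. By `det` and `cover`
  -- at most `c` edges leave `S`.
  module Cut {S : V → Set} (S? : Decidable S) {c : ℕ} (Code : Fin c → V → V → Set)
    (det : ∀ {k u v u' v'} → Code k u v → Code k u' v' → u ≡ u' × v ≡ v')
    (cover : ∀ {u v} → S u → ¬ S v → Adj u v → ∃ λ k → Code k u v) where

    -- Each pair `f x`, `g x` has a route leaving `S`. By pigeonhole two of them share a crossing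
    -- edge, hence their ends.
    too-many-crossings : ∀ {N} → c ℕ.< N → (f g : Fin N → Fin d) →
      (∀ x → S (φ (f x))) → (∀ x → ¬ S (φ (g x))) →
      (∀ x y → f x ≡ f y → g x ≡ g y → x ≡ y) → ⊥
    too-many-crossings c<N f g inside outside inj with Finₚ.pigeonhole c<N code
      where
      code : Fin _ → Fin c
      code x with uses-cross S? (inside x) (outside x)
      ... | u , v , Su , ¬Sv , m = proj₁ (cover Su ¬Sv (uses-adj m))
    ... | x , y , x<y , e
      with uses-cross S? (inside x) (outside x) | uses-cross S? (inside y) (outside y)
    ... | u , v , Su , ¬Sv , m | u' , v' , Su' , ¬Sv' , m'
      with cover Su ¬Sv (uses-adj m) | cover Su' ¬Sv' (uses-adj m')
    ... | k , r | k' , r' with refl ← e | refl , refl ← det r (subst (λ k → Code k u' v') (sym e) r')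
      with uses-unique m m'
    ... | inj₁ (ff , gg) = ℕₚ.<⇒≢ x<y (cong toℕ (inj x y ff gg))
    -- Ends matched crosswise would put an outside end inside `S`.
    ... | inj₂ (fg , _)  = outside y (subst (S ∘ φ) fg (inside x))

    -- For fixed `a` inside and `b` outside, every `x` is paired with whichever of the two lies
    -- across the cut. Only `a` and `b` yield the same pair, so omitting `a` leaves d - 1 distinct
    -- pairs.
    cross : Fin d → Fin d → Fin d → Fin d × Fin d
    cross a b x with S? (φ x)
    ... | yes _ = x , b
    ... | no _  = a , x

    cross-inside : ∀ {a b} → S (φ a) → ∀ x → S (φ (proj₁ (cross a b x)))
    cross-inside Sa x with S? (φ x)
    ... | yes Sx = Sx
    ... | no _   = Sa

    cross-outside : ∀ {a b} → ¬ S (φ b) → ∀ x → ¬ S (φ (proj₂ (cross a b x)))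
    cross-outside ¬Sb x with S? (φ x)
    ... | yes _  = ¬Sb
    ... | no ¬Sx = ¬Sx

    cross-injective : ∀ {a b} x y → x ≢ a → y ≢ a → proj₁ (cross a b x) ≡ proj₁ (cross a b y) →
                      proj₂ (cross a b x) ≡ proj₂ (cross a b y) → x ≡ y
    cross-injective x y x≢a y≢a e₁ e₂ with S? (φ x) | S? (φ y)
    ... | yes _ | yes _ = e₁
    ... | yes _ | no _  = contradiction e₁ x≢a
    ... | no _  | yes _ = contradiction (sym e₁) y≢a
    ... | no _  | no _  = e₂

    -- The d pairs: one pair through each x ≠ a, and for x = a the spare pair (a' , b').
    crossᵈ : Fin d → Fin d → Fin d → Fin d → Fin d → Fin d × Fin d
    crossᵈ a b a' b' x with x Fin.≟ a
    ... | yes _ = a' , b'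
    ... | no _  = cross a b x

    not-two-and-two : c ℕ.< d → ∀ {a a' b b'} → a ≢ a' → b ≢ b' →
      S (φ a) → S (φ a') → ¬ S (φ b) → ¬ S (φ b') → ⊥
    not-two-and-two c<d {a} {a'} {b} {b'} a≢a' b≢b' Sa Sa' ¬Sb ¬Sb' =
      too-many-crossings c<d (proj₁ ∘ pair) (proj₂ ∘ pair) inside outside inj
      where
      pair : Fin d → Fin d × Fin d
      pair = crossᵈ a b a' b'
      inside : ∀ x → S (φ (proj₁ (pair x)))
      inside x with x Fin.≟ a
      ... | yes _ = Sa'
      ... | no _  = cross-inside Sa x
      outside : ∀ x → ¬ S (φ (proj₂ (pair x)))
      outside x with x Fin.≟ a
      ... | yes _ = ¬Sb'
      ... | no _  = cross-outside ¬Sb x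
      -- Pairs from `cross` contain `a` or `b` in its own coordinate; the spare pair contains
      -- neither.
      spare : ∀ y → a' ≡ proj₁ (cross a b y) → b' ≡ proj₂ (cross a b y) → ⊥
      spare y e₁ e₂ with S? (φ y)
      ... | yes _ = b≢b' (sym e₂)
      ... | no _  = a≢a' (sym e₁)
      inj : ∀ x y → proj₁ (pair x) ≡ proj₁ (pair y) → proj₂ (pair x) ≡ proj₂ (pair y) → x ≡ y
      inj x y e₁ e₂ with x Fin.≟ a | y Fin.≟ a
      ... | yes x≡a | yes y≡a = trans x≡a (sym y≡a)
      ... | yes _   | no _    = ⊥-elim (spare y e₁ e₂)
      ... | no _    | yes _   = ⊥-elim (spare x (sym e₁) (sym e₂))
      ... | no x≢a  | no y≢a  = cross-injective x y x≢a y≢a e₁ e₂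

    not-one-and-one : ∀ {N} → d ≡ suc N → c ℕ.< N → ∀ {a b} → S (φ a) → ¬ S (φ b) → ⊥
    not-one-and-one refl c<N {a} {b} Sa ¬Sb =
      too-many-crossings c<N (proj₁ ∘ pair) (proj₂ ∘ pair)
        (cross-inside Sa ∘ punchIn a) (cross-outside ¬Sb ∘ punchIn a)
        λ x y e₁ e₂ → Finₚ.punchIn-injective a x y
          (cross-injective (punchIn a x) (punchIn a y) (Finₚ.punchInᵢ≢i a x) (Finₚ.punchInᵢ≢i a y) e₁ e₂)
      where
      pair : Fin _ → Fin d × Fin d
      pair x = cross a b (punchIn a x)

-- Reading propositions off Boolean tests.

∨-split : ∀ a {b} → a ∨ b ≡ true → a ≡ true ⊎ b ≡ true
∨-split true  _ = inj₁ refl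
∨-split false e = inj₂ e

∧-split : ∀ a {b} → a ∧ b ≡ true → a ≡ true × b ≡ true
∧-split a e = ∧-conicalˡ a _ e , ∧-conicalʳ a _ e

≡ᵇ-true⇒≡ : ∀ m n → (m ≡ᵇ n) ≡ true → m ≡ n
≡ᵇ-true⇒≡ m n e = ℕₚ.≡ᵇ⇒≡ m n (Equivalence.from T-≡ e)

≤ᵇ-true⇒≤ : ∀ m n → (m ℕ.≤ᵇ n) ≡ true → m ≤ n
≤ᵇ-true⇒≤ m n e = ℕₚ.≤ᵇ⇒≤ m n (Equivalence.from T-≡ e)

≡ᵇ-refl : ∀ n → (n ≡ᵇ n) ≡ true
≡ᵇ-refl n = Equivalence.to T-≡ (ℕₚ.≡⇒≡ᵇ n n refl)

≡ᵇ-sym : ∀ m n → (m ≡ᵇ n) ≡ (n ≡ᵇ m)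
≡ᵇ-sym zero    zero    = refl
≡ᵇ-sym zero    (suc n) = refl
≡ᵇ-sym (suc m) zero    = refl
≡ᵇ-sym (suc m) (suc n) = ≡ᵇ-sym m n

finEqᵇ-true⇒≡ : ∀ {n} (a b : Fin n) → finEqᵇ a b ≡ true → a ≡ b
finEqᵇ-true⇒≡ a b = Finₚ.toℕ-injective ∘ ≡ᵇ-true⇒≡ (toℕ a) (toℕ b)

finEqᵇ-refl : ∀ {n} (a : Fin n) → finEqᵇ a a ≡ true
finEqᵇ-refl a = ≡ᵇ-refl (toℕ a)

-- The edges removed from the complete graph.

data Removed : ℕ → ℕ → Set where
  r01 : Removed 0 1
  r12 : Removed 1 2
  r34 : Removed 3 4
  r45 : Removed 4 5
  r67 : Removed 6 7
  r78 : Removed 7 8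
  r68 : Removed 6 8
  -- The parity test on `9 + a` normalises to this test on `suc a`.
  matched : ∀ {a} → (suc a % 2 ≡ᵇ 1) ≡ true → Removed (9 + a) (10 + a)

removed : ∀ a b → removedℕ a b ≡ true → Removed a b
removed a b =
  [ pair r01 , [ pair r12 , [ pair r34 , [ pair r45 , [ pair r67 , [ pair r78 , [ pair r68 , match ]′
  ∘ ∨-split (pairIs a b 6 8) ]′ ∘ ∨-split (pairIs a b 7 8) ]′ ∘ ∨-split (pairIs a b 6 7) ]′
  ∘ ∨-split (pairIs a b 4 5) ]′ ∘ ∨-split (pairIs a b 3 4) ]′ ∘ ∨-split (pairIs a b 1 2) ]′
  ∘ ∨-split (pairIs a b 0 1)
  where
  pair : ∀ {x y} → Removed x y → pairIs a b x y ≡ true → Removed a b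
  pair {x} {y} r e with ∧-split (a ≡ᵇ x) e
  ... | e₁ , e₂ = subst₂ Removed (sym (≡ᵇ-true⇒≡ a x e₁)) (sym (≡ᵇ-true⇒≡ b y e₂)) r
  match : (9 ℕ.≤ᵇ a) ∧ (a % 2 ≡ᵇ 1) ∧ (b ≡ᵇ suc a) ≡ true → Removed a b
  match e with ∧-split (9 ℕ.≤ᵇ a) e
  ... | 9≤a , e' with ∧-split (a % 2 ≡ᵇ 1) e'
  ...   | odd , b≡ with ℕₚ.m≤n⇒∃[o]m+o≡n (≤ᵇ-true⇒≤ 9 a 9≤a) | ≡ᵇ-true⇒≡ b (suc a) b≡
  ...     | a' , refl | refl = matched odd

Mates : ℕ → ℕ → Set
Mates a b = Removed a b ⊎ Removed b a

-- mate₁ and mate₂ differ exactly at the five special vertices; the matching leaves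
-- an unmatched last vertex d when d is odd, and then mate₂ d = d + 1 is no vertex.
mate₁ mate₂ : ℕ → ℕ
mate₁ 1 = 0
mate₁ 4 = 3
mate₁ 6 = 7
mate₁ 7 = 8
mate₁ 8 = 6
mate₁ a = mate₂ a
mate₂ 0 = 1
mate₂ 1 = 2
mate₂ 2 = 1
mate₂ 3 = 4
mate₂ 4 = 5
mate₂ 5 = 4
mate₂ 6 = 8
mate₂ 7 = 6
mate₂ 8 = 7
mate₂ (suc (suc (suc (suc (suc (suc (suc (suc (suc a))))))))) =
  if suc a % 2 ≡ᵇ 1 then 10 + a else 8 + a

odd⇒pred-even : ∀ a → (suc a % 2 ≡ᵇ 1) ≡ true → (a % 2 ≡ᵇ 1) ≡ false
odd⇒pred-even zero          _ = refl
odd⇒pred-even (suc (suc a)) e = odd⇒pred-even a e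

mates : ∀ {a b} → Mates a b → b ≡ mate₁ a ⊎ b ≡ mate₂ a
mates (inj₁ r01) = inj₂ refl
mates (inj₁ r12) = inj₂ refl
mates (inj₁ r34) = inj₂ refl
mates (inj₁ r45) = inj₂ refl
mates (inj₁ r67) = inj₁ refl
mates (inj₁ r78) = inj₁ refl
mates (inj₁ r68) = inj₂ refl
mates (inj₁ (matched {a} odd)) rewrite odd = inj₂ refl
mates (inj₂ r01) = inj₁ refl
mates (inj₂ r12) = inj₁ refl
mates (inj₂ r34) = inj₁ refl
mates (inj₂ r45) = inj₁ refl
mates (inj₂ r67) = inj₂ refl
mates (inj₂ r78) = inj₂ refl
mates (inj₂ r68) = inj₁ refl
mates (inj₂ (matched {a} odd)) rewrite odd⇒pred-even a odd = inj₂ refl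

mate₂-irreflexive : ∀ a → mate₂ a ≢ a
mate₂-irreflexive 0 ()
mate₂-irreflexive 1 ()
mate₂-irreflexive 2 ()
mate₂-irreflexive 3 ()
mate₂-irreflexive 4 ()
mate₂-irreflexive 5 ()
mate₂-irreflexive 6 ()
mate₂-irreflexive 7 ()
mate₂-irreflexive 8 ()
mate₂-irreflexive (suc (suc (suc (suc (suc (suc (suc (suc (suc a))))))))) e
  with suc a % 2 ≡ᵇ 1
... | true  = ℕₚ.1+n≢n e
... | false = ℕₚ.1+n≢n (sym e)

P5adj-or-mates : ∀ d x y → P5adj d x y ≡ true ⊎ (x ≡ y ⊎ Mates (toℕ x) (toℕ y))
P5adj-or-mates d x y
  with finEqᵇ x y in e | removedℕ (toℕ x) (toℕ y) in e₁ | removedℕ (toℕ y) (toℕ x) in e₂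
... | true  | _     | _     = inj₂ (inj₁ (finEqᵇ-true⇒≡ x y e))
... | false | true  | _     = inj₂ (inj₂ (inj₁ (removed _ _ e₁)))
... | false | false | true  = inj₂ (inj₂ (inj₂ (removed _ _ e₂)))
... | false | false | false = inj₁ refl

P5adj-sym : ∀ d x y → P5adj d x y ≡ P5adj d y x
P5adj-sym d x y = cong₂ (λ a b → not a ∧ not b) (≡ᵇ-sym (toℕ x) (toℕ y))
  (∨-comm (removedℕ (toℕ x) (toℕ y)) (removedℕ (toℕ y) (toℕ x)))

P5adj-irreflexive : ∀ d x → P5adj d x x ≡ false
P5adj-irreflexive d x rewrite ≡ᵇ-refl (toℕ x) = refl

-- The five special vertices and their partners.

special : ∀ {k} → Fin 5 → Fin (9 + k)
special zero                         = # 1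
special (suc zero)                   = # 4
special (suc (suc zero))             = # 6
special (suc (suc (suc zero)))       = # 7
special (suc (suc (suc (suc zero)))) = # 8

special⁻¹ : ∀ {k} → Fin (9 + k) → Fin 5
special⁻¹ (suc zero)                                           = zero
special⁻¹ (suc (suc (suc (suc zero))))                         = suc zero
special⁻¹ (suc (suc (suc (suc (suc (suc zero))))))             = suc (suc zero)
special⁻¹ (suc (suc (suc (suc (suc (suc (suc zero)))))))       = suc (suc (suc zero))
special⁻¹ (suc (suc (suc (suc (suc (suc (suc (suc zero)))))))) = suc (suc (suc (suc zero)))
-- An arbitrary default: plain vertices have no bay neighbour to be coded.
special⁻¹ _                                                    = zero

special⁻¹-special : ∀ {k} κ → special⁻¹ {k} (special κ) ≡ κ
special⁻¹-special zero                         = refl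
special⁻¹-special (suc zero)                   = refl
special⁻¹-special (suc (suc zero))             = refl
special⁻¹-special (suc (suc (suc zero)))       = refl
special⁻¹-special (suc (suc (suc (suc zero)))) = refl

toℕ-special : ∀ {k} κ → toℕ (special {k} κ) ≡ specialℕ κ
toℕ-special zero                         = refl
toℕ-special (suc zero)                   = refl
toℕ-special (suc (suc zero))             = refl
toℕ-special (suc (suc (suc zero)))       = refl
toℕ-special (suc (suc (suc (suc zero)))) = refl

special-injective : ∀ {k κ κ'} → special {k} κ ≡ special κ' → κ ≡ κ'
special-injective {κ = κ} {κ'} e =
  trans (sym (special⁻¹-special κ)) (trans (cong special⁻¹ e) (special⁻¹-special κ'))

Special : ∀ {k} → Fin (9 + k) → Set
Special x = ∃ λ κ → x ≡ special κ

special? : ∀ {k} → Decidable (Special {k})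
special? x = Finₚ.any? λ κ → x Fin.≟ special κ

-- One of the two removed neighbours of each special vertex: an end of its path, or the next vertex
-- around the triangle.
partner : ∀ {k} → Fin 5 → Fin (9 + k)
partner zero                         = # 0
partner (suc zero)                   = # 3
partner (suc (suc zero))             = # 7
partner (suc (suc (suc zero)))       = # 8
partner (suc (suc (suc (suc zero)))) = # 6

toℕ-partner : ∀ {k} κ → toℕ (partner {k} κ) ≡ mate₁ (toℕ (special {k} κ))
toℕ-partner zero                         = refl
toℕ-partner (suc zero)                   = refl
toℕ-partner (suc (suc zero))             = refl
toℕ-partner (suc (suc (suc zero)))       = refl
toℕ-partner (suc (suc (suc (suc zero)))) = refl

partner-nonadjacent : ∀ {k} κ → P5adj (8 + k) (special κ) (partner κ) ≡ false
partner-nonadjacent zero                         = refl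
partner-nonadjacent (suc zero)                   = refl
partner-nonadjacent (suc (suc zero))             = refl
partner-nonadjacent (suc (suc (suc zero)))       = refl
partner-nonadjacent (suc (suc (suc (suc zero)))) = refl

partner≢special : ∀ {k} κ → partner {k} κ ≢ special κ
partner≢special zero                         ()
partner≢special (suc zero)                   ()
partner≢special (suc (suc zero))             ()
partner≢special (suc (suc (suc zero)))       ()
partner≢special (suc (suc (suc (suc zero)))) ()

plain-mate₁≡mate₂ : ∀ {k} (x : Fin (9 + k)) → ¬ Special x → mate₁ (toℕ x) ≡ mate₂ (toℕ x)
plain-mate₁≡mate₂ zero _ = refl
plain-mate₁≡mate₂ (suc zero) ¬s = contradiction (zero , refl) ¬s
plain-mate₁≡mate₂ (suc (suc zero)) _ = refl
plain-mate₁≡mate₂ (suc (suc (suc zero))) _ = refl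
plain-mate₁≡mate₂ (suc (suc (suc (suc zero)))) ¬s = contradiction (suc zero , refl) ¬s
plain-mate₁≡mate₂ (suc (suc (suc (suc (suc zero))))) _ = refl
plain-mate₁≡mate₂ (suc (suc (suc (suc (suc (suc zero)))))) ¬s =
  contradiction (suc (suc zero) , refl) ¬s
plain-mate₁≡mate₂ (suc (suc (suc (suc (suc (suc (suc zero))))))) ¬s =
  contradiction (suc (suc (suc zero)) , refl) ¬s
plain-mate₁≡mate₂ (suc (suc (suc (suc (suc (suc (suc (suc zero)))))))) ¬s =
  contradiction (suc (suc (suc (suc zero))) , refl) ¬s
plain-mate₁≡mate₂ (suc (suc (suc (suc (suc (suc (suc (suc (suc x))))))))) _ = refl

mate₂-vertex : ∀ {k} (x : Fin (9 + k)) →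
               ∃ λ r → r ≢ x × (∀ y → toℕ y ≡ mate₂ (toℕ x) → y ≡ r)
mate₂-vertex x with Finₚ.any? (λ r → toℕ r ℕ.≟ mate₂ (toℕ x))
... | yes (r , e) = r , (λ { refl → mate₂-irreflexive (toℕ x) (sym e) }) ,
                    λ y e' → Finₚ.toℕ-injective (trans e' (sym e))
-- Here the second mate is not a vertex. Any vertex other than `x` may serve as `r`, since the count
-- of d - 1 only needs one more to discard.
... | no none     = punchIn x zero , Finₚ.punchInᵢ≢i x zero , λ y e → contradiction (y , e) none

-- Degree bounds from injections.

unique-lookup-injective : ∀ {A : Set} {xs : List A} → Unique xs → ∀ i j →
                          lookup xs i ≡ lookup xs j → i ≡ j
unique-lookup-injective (x∉ ∷ u) zero    zero    _ = refl
unique-lookup-injective (x∉ ∷ u) zero    (suc j) e = contradiction e (All.lookup x∉ (∈-lookup j))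
unique-lookup-injective (x∉ ∷ u) (suc i) zero    e = contradiction (sym e) (All.lookup x∉ (∈-lookup i))
unique-lookup-injective (x∉ ∷ u) (suc i) (suc j) e = cong suc (unique-lookup-injective u i j e)

module _ {V : Set} (adj : V → V → Bool) (allV : List V) where
  open GraphNotions adj

  private
    neighbour? : ∀ v u → _
    neighbour? v u = T? (adj v u)

  degree-lower-bound : (∀ v → v ∈ allV) → ∀ v {N} (f : Fin N → V) → (∀ x → Adj v (f x)) →
                       (∀ x y → f x ≡ f y → x ≡ y) → N ≤ degree allV v
  degree-lower-bound complete v f f-adj f-inj = Finₚ.injective⇒≤ {f = index ∘ mem} λ {x} {y} e →
    f-inj x y (trans (lookup-index (mem x))
      (trans (cong (lookup (filterᵇ (adj v) allV)) e) (sym (lookup-index (mem y)))))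
    where
    mem : ∀ x → f x ∈ filterᵇ (adj v) allV
    mem x = ∈-filter⁺ (neighbour? v) (complete (f x)) (Equivalence.from T-≡ (f-adj x))

  degree-upper-bound : Unique allV → ∀ v {N} (code : ∀ u → Adj v u → Fin N) →
                       (∀ u u' a a' → code u a ≡ code u' a' → u ≡ u') → degree allV v ≤ N
  degree-upper-bound unique v code code-inj = Finₚ.injective⇒≤ {f = λ i → code _ (nbr-adj i)} λ {i} {j} e →
    unique-lookup-injective (Uniqueₚ.filter⁺ (neighbour? v) unique) i j
      (code-inj _ _ (nbr-adj i) (nbr-adj j) e)
    where
    nbr-adj : ∀ i → Adj v (lookup (filterᵇ (adj v) allV) i)
    nbr-adj i = Equivalence.to T-≡ (proj₂ (∈-filter⁻ (neighbour? v) {xs = allV} (∈-lookup i)))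

-- The vertex list of the host graph.

allHV-complete : ∀ d n m v → v ∈ allHV d n m
allHV-complete d n m (inj₁ (i , p)) =
  ∈-++⁺ˡ (∈-map⁺ inj₁ (∈-cartesianProduct⁺ (∈-allFin i) (∈-allFin p)))
allHV-complete d n m (inj₂ (c , x)) =
  ∈-++⁺ʳ _ (∈-map⁺ inj₂ (∈-cartesianProduct⁺ (∈-allFin c) (∈-allFin x)))

allHV-unique : ∀ d n m → Unique (allHV d n m)
allHV-unique d n m =
  Uniqueₚ.++⁺
    (Uniqueₚ.map⁺ (λ { refl → refl })
      (Uniqueₚ.cartesianProduct⁺ (Uniqueₚ.allFin⁺ n) (Uniqueₚ.allFin⁺ (d ∸ 2))))
    (Uniqueₚ.map⁺ (λ { refl → refl })
      (Uniqueₚ.cartesianProduct⁺ (Uniqueₚ.allFin⁺ m) (Uniqueₚ.allFin⁺ (suc d))))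
    λ { (v∈₁ , v∈₂) → disjoint (∈-map⁻ inj₁ v∈₁) (∈-map⁻ inj₂ v∈₂) }
  where
  disjoint : ∀ {A B : Set} {xs ys} {v : A ⊎ B} →
             (∃ λ x → x ∈ xs × v ≡ inj₁ x) → (∃ λ y → y ∈ ys × v ≡ inj₂ y) → ⊥
  disjoint (_ , _ , refl) (_ , _ , ())

-- The cyclic order of the bays.

PredMod : ∀ {n} → Fin n → Fin n → Set
PredMod {n} i i' = suc (toℕ i') ≡ toℕ i ⊎ (toℕ i ≡ 0 × suc (toℕ i') ≡ n)

predMod-functional : ∀ {n} {i i' i'' : Fin n} → PredMod i i' → PredMod i i'' → i' ≡ i''
predMod-functional (inj₁ e)       (inj₁ e')       =
  Finₚ.toℕ-injective (ℕₚ.suc-injective (trans e (sym e')))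
predMod-functional (inj₁ e)       (inj₂ (e' , _)) = contradiction (trans e e') λ ()
predMod-functional (inj₂ (e , _)) (inj₁ e')       = contradiction (trans e' e) λ ()
predMod-functional (inj₂ (_ , e)) (inj₂ (_ , e')) =
  Finₚ.toℕ-injective (ℕₚ.suc-injective (trans e (sym e')))

predMod-injective : ∀ {n} {i j i' : Fin n} → PredMod i i' → PredMod j i' → i ≡ j
predMod-injective (inj₁ e)        (inj₁ e')        = Finₚ.toℕ-injective (trans (sym e) e')
predMod-injective {i = i} (inj₁ e) (inj₂ (_ , e')) = contradiction (trans (sym e) e') (ℕₚ.<⇒≢ (Finₚ.toℕ<n i))
predMod-injective {j = j} (inj₂ (_ , e)) (inj₁ e') = contradiction (trans (sym e') e) (ℕₚ.<⇒≢ (Finₚ.toℕ<n j))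
predMod-injective (inj₂ (e , _))  (inj₂ (e' , _))  = Finₚ.toℕ-injective (trans e (sym e'))

-- Adjacency and degrees in the host graph.

module Host (k n m : ℕ) (β : Fin m → Fin n) (t : Fin m → Fin 5 → Fin (6 + k)) where

  d : ℕ
  d = 8 + k

  V : Set
  V = HV d n m

  adj : V → V → Bool
  adj = Hadj d n m β t

  open GraphNotions adj using (Adj)

  Linked : BayV d n → BayV d n → Set
  Linked (i , p) (i' , p') = PredMod i i' × toℕ p ℕ.< ⌈ 6 + k /2⌉ × suc (toℕ p') + suc (toℕ p) ≡ 7 + k

  linked-functional : ∀ {a b b'} → Linked a b → Linked a b' → b ≡ b'
  linked-functional (pm , _ , s) (pm' , _ , s') =
    cong₂ _,_ (predMod-functional pm pm')
      (Finₚ.toℕ-injective (ℕₚ.suc-injective (ℕₚ.+-cancelʳ-≡ _ _ _ (trans s (sym s')))))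

  link⇒linked : ∀ a b → link d n a b ≡ true → Linked a b
  link⇒linked (i , p) (i' , p') e with ∧-split (isPredMod i i') e
  ... | e₁ , e' with ∧-split (suc (toℕ p) ℕ.≤ᵇ ⌈ 6 + k /2⌉) e'
  ...   | e₂ , e₃ = predMod (∨-split (suc (toℕ i') ≡ᵇ toℕ i) e₁) , ≤ᵇ-true⇒≤ _ _ e₂ , ≡ᵇ-true⇒≡ _ _ e₃
    where
    predMod : (suc (toℕ i') ≡ᵇ toℕ i) ≡ true ⊎ (toℕ i ≡ᵇ 0) ∧ (suc (toℕ i') ≡ᵇ n) ≡ true → PredMod i i'
    predMod (inj₁ e) = inj₁ (≡ᵇ-true⇒≡ _ _ e)
    predMod (inj₂ e) with ∧-split (toℕ i ≡ᵇ 0) e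
    ... | e₁ , e₂ = inj₂ (≡ᵇ-true⇒≡ _ _ e₁ , ≡ᵇ-true⇒≡ _ _ e₂)

  bay-irreflexive : ∀ a → ¬ Adj (inj₁ a) (inj₁ a)
  bay-irreflexive (i , p) e rewrite finEqᵇ-refl i | finEqᵇ-refl p = contradiction e λ ()

  bay-adj : ∀ a b → Adj (inj₁ a) (inj₁ b) → proj₁ a ≡ proj₁ b ⊎ (Linked a b ⊎ Linked b a)
  bay-adj a@(i , p) b@(i' , p') e
    with ∨-split (finEqᵇ i i') (proj₂ (∧-split (not (finEqᵇ i i' ∧ finEqᵇ p p')) e))
  ... | inj₁ e₁ = inj₁ (finEqᵇ-true⇒≡ i i' e₁)
  ... | inj₂ e₂ with ∨-split (link d n a b) e₂
  ...   | inj₁ e₃ = inj₂ (inj₁ (link⇒linked a b e₃))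
  ...   | inj₂ e₃ = inj₂ (inj₂ (link⇒linked b a e₃))

  attach-elim : ∀ b c x → attach d n m β t b (c , x) ≡ true →
                ∃ λ κ → x ≡ special κ × b ≡ (β c , t c κ)
  attach-elim (i , p) c x e with ∧-split (finEqᵇ (β c) i) e
  ... | eᵢ , e₀ =
    [ hit zero , [ hit (suc zero) , [ hit (suc (suc zero)) ,
    [ hit (suc (suc (suc zero))) , hit (suc (suc (suc (suc zero)))) ]′
      ∘ ∨-split (test (suc (suc (suc zero)))) ]′ ∘ ∨-split (test (suc (suc zero))) ]′
      ∘ ∨-split (test (suc zero)) ]′ (∨-split (test zero) e₀)
    where
    test : Fin 5 → Bool
    test κ = (toℕ x ≡ᵇ specialℕ κ) ∧ finEqᵇ (t c κ) p
    hit : ∀ κ → test κ ≡ true → ∃ λ κ → x ≡ special κ × (i , p) ≡ (β c , t c κ)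
    hit κ e with ∧-split (toℕ x ≡ᵇ specialℕ κ) e
    ... | eₓ , eₚ = κ ,
      Finₚ.toℕ-injective (trans (≡ᵇ-true⇒≡ (toℕ x) (specialℕ κ) eₓ) (sym (toℕ-special κ))) ,
      cong₂ _,_ (sym (finEqᵇ-true⇒≡ (β c) i eᵢ)) (sym (finEqᵇ-true⇒≡ (t c κ) p eₚ))

  attach-intro : ∀ c κ → attach d n m β t (β c , t c κ) (c , special κ) ≡ true
  attach-intro c κ rewrite finEqᵇ-refl (β c) with κ
  ... | zero                         rewrite finEqᵇ-refl (t c zero) = refl
  ... | suc zero                     rewrite finEqᵇ-refl (t c (suc zero)) = refl
  ... | suc (suc zero)               rewrite finEqᵇ-refl (t c (suc (suc zero))) = refl
  ... | suc (suc (suc zero))         rewrite finEqᵇ-refl (t c (suc (suc (suc zero)))) = refl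
  ... | suc (suc (suc (suc zero)))   rewrite finEqᵇ-refl (t c (suc (suc (suc (suc zero))))) = refl

  copy-adj : ∀ c x c' y → Adj (inj₂ (c , x)) (inj₂ (c' , y)) → c ≡ c' × P5adj d x y ≡ true
  copy-adj c x c' y e with ∧-split (finEqᵇ c c') e
  ... | e₁ , e₂ = finEqᵇ-true⇒≡ c c' e₁ , e₂

  adj-sym : ∀ {u v} → Adj u v → Adj v u
  adj-sym {inj₁ (i , p)} {inj₁ (i' , p')} e = trans (sym (cong₂ _∧_
    (cong not (cong₂ _∧_ (≡ᵇ-sym (toℕ i) (toℕ i')) (≡ᵇ-sym (toℕ p) (toℕ p'))))
    (cong₂ _∨_ (≡ᵇ-sym (toℕ i) (toℕ i'))
      (∨-comm (link d n (i , p) (i' , p')) (link d n (i' , p') (i , p)))))) e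
  adj-sym {inj₁ _} {inj₂ _} e = e
  adj-sym {inj₂ _} {inj₁ _} e = e
  adj-sym {inj₂ (c , x)} {inj₂ (c' , y)} e =
    trans (sym (cong₂ _∧_ (≡ᵇ-sym (toℕ c) (toℕ c')) (P5adj-sym d x y))) e

  -- The one edge from a special vertex x to the bays takes the place of the removed edge
  -- from x to its partner, so neighbours are coded by the vertices of P⁵ other than x.
  code : Fin (9 + k) → V → Fin (9 + k)
  code x (inj₁ _)       = partner (special⁻¹ x)
  code x (inj₂ (_ , y)) = y

  bay-neighbour-code : ∀ c x b → Adj (inj₂ (c , x)) (inj₁ b) →
    ∃ λ κ → x ≡ special κ × b ≡ (β c , t c κ) × code x (inj₁ b) ≡ partner κ
  bay-neighbour-code c x b e with attach-elim b c x e
  ... | κ , refl , refl = κ , refl , refl , cong partner (special⁻¹-special κ)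

  code≢ : ∀ c x v → Adj (inj₂ (c , x)) v → code x v ≢ x
  code≢ c x (inj₁ b) e eq with bay-neighbour-code c x b e
  ... | κ , refl , _ , e' = partner≢special κ (trans (sym e') eq)
  code≢ c x (inj₂ (c' , y)) e refl =
    contradiction (trans (sym (proj₂ (copy-adj c x c' y e))) (P5adj-irreflexive d x)) λ ()

  -- The bay edge is coded by a removed neighbour, which no edge inside the copy can reach.
  code-separates : ∀ c x b c' y → Adj (inj₂ (c , x)) (inj₁ b) → Adj (inj₂ (c , x)) (inj₂ (c' , y)) →
                   code x (inj₁ b) ≢ y
  code-separates c x b c' y e e' eq with bay-neighbour-code c x b e
  ... | κ , refl , _ , eq' = contradiction (trans (sym (proj₂ (copy-adj c x c' y e')))
    (trans (cong (P5adj d x) (trans (sym eq) eq')) (partner-nonadjacent κ))) λ ()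

  code-injective : ∀ c x u v → Adj (inj₂ (c , x)) u → Adj (inj₂ (c , x)) v →
                   code x u ≡ code x v → u ≡ v
  code-injective c x (inj₁ b) (inj₁ b') e e' _
    with bay-neighbour-code c x b e | bay-neighbour-code c x b' e'
  ... | κ , refl , refl , _ | κ' , eq , refl , _ rewrite special-injective {κ = κ} {κ'} eq = refl
  code-injective c x (inj₁ b) (inj₂ (c' , y)) e e' eq =
    contradiction eq (code-separates c x b c' y e e')
  code-injective c x (inj₂ (c' , y)) (inj₁ b) e e' eq =
    contradiction (sym eq) (code-separates c x b c' y e' e)
  code-injective c x (inj₂ (c' , y)) (inj₂ (c'' , _)) e e' refl
    with copy-adj c x c' y e | copy-adj c x c'' y e'
  ... | refl , _ | refl , _ = refl

  -- A vertex `y` not joined to `x` is a mate of `x`. Being different from `r` it is the first mate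
  -- of a special vertex, whose code the bay edge supplies.
  neighbour-coded : ∀ c x {r} → (∀ y → toℕ y ≡ mate₂ (toℕ x) → y ≡ r) →
                    ∀ y → y ≢ x → y ≢ r → ∃ λ v → Adj (inj₂ (c , x)) v × code x v ≡ y
  neighbour-coded c x mate≡r y y≢x y≢r with P5adj-or-mates d x y
  ... | inj₁ e = inj₂ (c , y) , cong₂ _∧_ (finEqᵇ-refl c) e , refl
  ... | inj₂ (inj₁ x≡y) = contradiction (sym x≡y) y≢x
  ... | inj₂ (inj₂ r) with mates r | special? x
  ...   | inj₂ e | _ = contradiction (mate≡r y e) y≢r
  ...   | inj₁ e | no plain = contradiction (mate≡r y (trans e (plain-mate₁≡mate₂ x plain))) y≢r
  ...   | inj₁ e | yes (κ , refl) = inj₁ (β c , t c κ) , attach-intro c κ ,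
    trans (cong partner (special⁻¹-special κ)) (Finₚ.toℕ-injective (trans (toℕ-partner κ) (sym e)))

  copy-degree : ∀ c x → 7 + k ≤ Hdeg d n m β t (inj₂ (c , x))
  copy-degree c x with mate₂-vertex x
  ... | r , r≢x , mate≡r = degree-lower-bound adj _ (allHV-complete d n m) (inj₂ (c , x))
    (proj₁ ∘ nbr) (proj₁ ∘ proj₂ ∘ nbr) λ z z' e →
      Finₚ.punchIn-injective _ z z' (Finₚ.punchIn-injective x _ _
        (trans (sym (proj₂ (proj₂ (nbr z)))) (trans (cong (code x) e) (proj₂ (proj₂ (nbr z'))))))
    where
    label : Fin (7 + k) → Fin (9 + k)
    -- Enumerates the d - 1 vertices of the copy other than `x` and `r`.
    label z = punchIn x (punchIn (punchOut (≢-sym r≢x)) z)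
    label≢r : ∀ z → label z ≢ r
    label≢r z e = Finₚ.punchInᵢ≢i (punchOut (≢-sym r≢x)) z
      (Finₚ.punchIn-injective x _ _ (trans e (sym (Finₚ.punchIn-punchOut (≢-sym r≢x)))))
    nbr : ∀ z → ∃ λ v → Adj (inj₂ (c , x)) v × code x v ≡ label z
    nbr z = neighbour-coded c x mate≡r (label z) (Finₚ.punchInᵢ≢i x _) (label≢r z)

  -- Witnesses that the minimum d - 1 is attained: vertex 0 is a plain path end that loses only its
  -- edge to vertex 1, so its neighbours are coded by 2, ..., d.
  copy-degree-zero : ∀ c → Hdeg d n m β t (inj₂ (c , zero)) ≡ 7 + k
  copy-degree-zero c = ℕₚ.≤-antisym
    (degree-upper-bound adj _ (allHV-unique d n m) (inj₂ (c , zero)) (λ v e → proj₁ (far v e))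
      λ u v e e' eq → code-injective c zero u v e e'
        (trans (proj₂ (far u e)) (trans (cong (λ z → Fin.suc (Fin.suc z)) eq) (sym (proj₂ (far v e'))))))
    (copy-degree c zero)
    where
    far : ∀ v → Adj (inj₂ (c , zero)) v → ∃ λ z → code zero v ≡ suc (suc z)
    far (inj₁ b) e with bay-neighbour-code c zero b e
    ... | zero                         , () , _
    ... | suc zero                     , () , _
    ... | suc (suc zero)               , () , _
    ... | suc (suc (suc zero))         , () , _
    ... | suc (suc (suc (suc zero)))   , () , _
    far (inj₂ (c' , zero))        e = contradiction refl (code≢ c zero (inj₂ (c' , zero)) e)
    far (inj₂ (c' , suc zero))    e = contradiction (proj₂ (copy-adj c zero c' (suc zero) e)) λ ()
    far (inj₂ (c' , suc (suc z))) e = z , refl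

  bay-degree-without-copies : ¬ Fin m → ∀ i → Hdeg d n m β t (inj₁ (i , zero)) ≤ 6 + k
  bay-degree-without-copies none i =
    degree-upper-bound adj _ (allHV-unique d n m) (inj₁ (i , zero)) (λ v _ → pos v) pos-inj
    where
    pos : V → Fin (6 + k)
    pos (inj₂ (c , _)) = contradiction c none
    pos (inj₁ (i' , p)) with i Fin.≟ i'
    ... | yes _ = p
    ... | no _  = zero
    linked : ∀ b → Adj (inj₁ (i , zero)) (inj₁ b) → i ≢ proj₁ b → Linked (i , zero) b
    linked b e i≢ with bay-adj (i , zero) b e
    ... | inj₁ i≡                      = contradiction i≡ i≢
    ... | inj₂ (inj₁ l)                = l
    -- A link arriving at position 0 would start at `p` = d - 3, which is beyond the first half of a
    -- bay.
    ... | inj₂ (inj₂ (_ , p<h , sum))  = contradiction p<h (ℕₚ.≤⇒≯ (ℕₚ.≤-trans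
      (ℕₚ.+-monoʳ-≤ 3 (ℕₚ.≤-trans (ℕₚ.⌈n/2⌉≤n k) (ℕₚ.m≤n+m k 2)))
      (ℕₚ.≤-reflexive (sym (ℕₚ.suc-injective (ℕₚ.suc-injective sum))))))
    pos-inj : ∀ u v → Adj (inj₁ (i , zero)) u → Adj (inj₁ (i , zero)) v → pos u ≡ pos v → u ≡ v
    pos-inj (inj₂ (c , _)) _ = contradiction c none
    pos-inj (inj₁ _) (inj₂ (c , _)) = contradiction c none
    pos-inj (inj₁ (i₁ , p₁)) (inj₁ (i₂ , p₂)) e₁ e₂ eq with i Fin.≟ i₁ | i Fin.≟ i₂
    ... | yes refl | yes refl = cong (inj₁ ∘ (i ,_)) eq
    ... | yes refl | no _     = contradiction
      (subst (λ p → Adj (inj₁ (i , zero)) (inj₁ (i , p))) eq e₁) (bay-irreflexive (i , zero))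
    ... | no _     | yes refl = contradiction
      (subst (λ p → Adj (inj₁ (i , zero)) (inj₁ (i , p))) (sym eq) e₂) (bay-irreflexive (i , zero))
    ... | no i≢i₁  | no i≢i₂  = cong inj₁ (linked-functional (linked _ e₁ i≢i₁) (linked _ e₂ i≢i₂))

-- Applied to d branch vertices among the d + 1 vertices of a copy. Were a second value missed,
-- adjoining both to the image would give N + 2 distinct values in `Fin (suc N)`.
missed-vertex : ∀ {N} (f : Fin N → Fin (suc N)) → (∀ i j → f i ≡ f j → i ≡ j) →
                ∃ λ w → (∀ i → f i ≢ w) × (∀ y → y ≢ w → ∃ λ i → f i ≡ y)
missed-vertex {N} f f-inj with Finₚ.any? (λ w → ¬? (Finₚ.any? λ i → f i Fin.≟ w))
... | no onto = contradiction (Finₚ.pigeonhole (ℕₚ.n<1+n N) (proj₁ ∘ preimage)) λ (w , w' , w<w' , e) →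
    ℕₚ.<⇒≢ w<w' (cong toℕ (trans (sym (proj₂ (preimage w))) (trans (cong f e) (proj₂ (preimage w')))))
  where
  preimage : ∀ w → ∃ λ i → f i ≡ w
  preimage w = decidable-stable (Finₚ.any? λ i → f i Fin.≟ w) λ none → onto (w , none)
... | yes (w , w-missed) = w , (λ i e → w-missed (i , e)) , λ y y≢w →
    decidable-stable (Finₚ.any? λ i → f i Fin.≟ y) (second-missed y y≢w)
  where
  second-missed : ∀ y → y ≢ w → ¬ ¬ ∃ λ i → f i ≡ y
  second-missed y y≢w y-missed = clash (Finₚ.pigeonhole (ℕₚ.n<1+n (suc N)) extended)
    where
    extended : Fin (2 + N) → Fin (suc N)
    extended zero          = w
    extended (suc zero)    = y
    extended (suc (suc i)) = f i
    clash : (∃₂ λ i j → i < j × extended i ≡ extended j) → ⊥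
    clash (zero        , suc zero    , _ , e) = y≢w (sym e)
    clash (zero        , suc (suc j) , _ , e) = w-missed (j , sym e)
    clash (suc zero    , suc zero    , s≤s () , _)
    clash (suc zero    , suc (suc j) , _ , e) = y-missed (j , sym e)
    clash (suc (suc i) , suc (suc j) , s≤s (s≤s i<j) , e) = ℕₚ.<⇒≢ i<j (cong toℕ (f-inj i j e))
    clash (suc (suc i) , suc zero    , s≤s () , _)

-- Copies cannot separate branch vertices.

module NoImmersion (k n m : ℕ) (β : Fin m → Fin n) (t : Fin m → Fin 5 → Fin (6 + k))
                   (imm : HImmersesK (8 + k) n m β t (8 + k)) where
  open Host k n m β t
  open GraphNotions adj using (Adj)
  open Immersed adj (λ {u} {v} → adj-sym {u} {v}) imm

  InCopy : Fin m → V → Set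
  InCopy c v = ∃ λ x → v ≡ inj₂ (c , x)

  inCopy? : ∀ c → Decidable (InCopy c)
  inCopy? c (inj₁ _) = no λ ()
  inCopy? c (inj₂ (c' , x)) with c' Fin.≟ c
  ... | yes refl = yes (x , refl)
  ... | no c'≢c  = no λ { (_ , refl) → c'≢c refl }

  -- Five edges leave a copy, while a separation needs at least d - 1 ≥ 7 routes across.
  copy-undivided : ∀ c {a b} → InCopy c (φ a) → ¬ InCopy c (φ b) → ⊥
  copy-undivided c = not-one-and-one refl (ℕₚ.m≤m+n 6 (suc k))
    where
    Exit : Fin 5 → V → V → Set
    Exit κ u v = u ≡ inj₂ (c , special κ) × v ≡ inj₁ (β c , t c κ)
    cover : ∀ {u v} → InCopy c u → ¬ InCopy c v → Adj u v → ∃ λ κ → Exit κ u v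
    cover {v = inj₁ b} (x , refl) _ e with attach-elim b c x e
    ... | κ , refl , refl = κ , refl , refl
    cover {v = inj₂ (c' , y)} (x , refl) out e with copy-adj c x c' y e
    ... | refl , _ = contradiction (y , refl) out
    functional : ∀ {κ u v u' v'} → Exit κ u v → Exit κ u' v' → u ≡ u' × v ≡ v'
    functional (refl , refl) (refl , refl) = refl , refl
    open Cut (inCopy? c) Exit functional cover

  -- All branch vertices in one copy, which misses only `w`.

  module InOneCopy (c : Fin m) (pos : Fin d → Fin (9 + k)) (φ≡ : ∀ i → φ i ≡ inj₂ (c , pos i))
    (w : Fin (9 + k)) (pos≢w : ∀ i → pos i ≢ w) (at : ∀ y → y ≢ w → ∃ λ i → pos i ≡ y) where

    P : Fin (9 + k) → V
    P x = inj₂ (c , x)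

    P-injective : ∀ {x y} → P x ≡ P y → x ≡ y
    P-injective refl = refl

    UsesP : Fin (9 + k) → Fin (9 + k) → V → V → Set
    UsesP x y u v = ∃₂ λ i j → pos i ≡ x × pos j ≡ y × Uses i j u v

    usesP-swap : ∀ {x y u v} → UsesP x y u v → UsesP y x u v
    usesP-swap (i , j , ex , ey , m) = j , i , ey , ex , uses-swap m

    usesP-unique : ∀ {x y x' y' u v} → UsesP x y u v → UsesP x' y' u v → SamePair x y x' y'
    usesP-unique (i , j , refl , refl , m) (i' , j' , refl , refl , m') with uses-unique m m'
    ... | inj₁ (refl , refl) = inj₁ (refl , refl)
    ... | inj₂ (refl , refl) = inj₂ (refl , refl)

    -- Neighbours of `z` are coded by the d vertices of the copy other than `z`, as
    -- `branch-not-interior` requires.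
    branch-degree≤d : ∀ {x y u z} → z ≢ w → UsesP x y u (P z) → z ≡ x ⊎ z ≡ y
    branch-degree≤d {z = z} z≢w (p , q , refl , refl , m) with at z z≢w
    ... | i , refl with branch-not-interior i enc enc-inj (subst (Uses p q _) (sym (φ≡ i)) m)
      where
      near : ∀ {v} → Adj (φ i) v → Adj (P (pos i)) v
      near = subst (λ u → Adj u _) (φ≡ i)
      code≢pos : ∀ v → Adj (φ i) v → pos i ≢ code (pos i) v
      code≢pos v e = ≢-sym (code≢ c (pos i) v (near {v} e))
      enc : ∀ v → Adj (φ i) v → Fin d
      enc v e = punchOut (code≢pos v e)
      enc-inj : ∀ {u v} a b → enc u a ≡ enc v b → u ≡ v
      enc-inj {u} {v} a b e = code-injective c (pos i) u v (near {u} a) (near {v} b)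
        (Finₚ.punchOut-injective (code≢pos u a) (code≢pos v b) e)
    ...   | inj₁ refl = inj₁ refl
    ...   | inj₂ refl = inj₂ refl

    -- The only edge from `w` to the bays exists when `w` is special, and at most one route can use
    -- it.
    Out : Fin (9 + k) → Fin (9 + k) → Set
    Out x y = ∃ λ b → UsesP x y (P w) (inj₁ b)

    -- A first step inside the copy to a vertex other than `w` would reach a branch vertex, hence an
    -- end of the route; but `x` is not its own neighbour, nor is `y` one.
    leave : ∀ x y → x ≢ w → y ≢ w → x ≢ y → P5adj d x y ≡ false →
            UsesP x y (P x) (P w) ⊎ (∃ λ b → UsesP x y (P x) (inj₁ b))
    leave x y x≢w y≢w x≢y nonadj with at x x≢w | at y y≢w
    ... | i , refl | j , refl with uses-start (x≢y ∘ cong pos)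
    ...   | v , m = classify v (subst (λ u → Uses i j u v) (φ≡ i) m)
      where
      classify : ∀ v → Uses i j (P (pos i)) v →
                 UsesP (pos i) (pos j) (P (pos i)) (P w) ⊎ (∃ λ b → UsesP (pos i) (pos j) (P (pos i)) (inj₁ b))
      classify (inj₁ b) m = inj₂ (b , i , j , refl , refl , m)
      classify (inj₂ (c' , z)) m with copy-adj c (pos i) c' z (uses-adj m)
      ... | refl , adj-z with z Fin.≟ w
      ...   | yes refl = inj₁ (i , j , refl , refl , m)
      ...   | no z≢w with branch-degree≤d z≢w (i , j , refl , refl , m)
      ...     | inj₁ refl = contradiction (trans (sym adj-z) (P5adj-irreflexive d z)) λ ()
      ...     | inj₂ refl = contradiction (trans (sym adj-z) nonadj) λ ()

    -- Since `w` is no branch vertex the route continues, without turning back to `x`. Inside the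
    -- copy it can then only reach its other end.
    through : ∀ {x y} → UsesP x y (P x) (P w) → UsesP x y (P y) (P w) ⊎ Out x y
    through (i , j , refl , refl , m)
      with uses-continue m (λ e → pos≢w i (sym (P-injective (trans e (φ≡ i)))))
                           (λ e → pos≢w j (sym (P-injective (trans e (φ≡ j)))))
    ... | inj₁ b , _ , m' = inj₂ (b , i , j , refl , refl , m')
    ... | inj₂ (c' , z) , z≢i , m' with copy-adj c w c' z (uses-adj m')
    ...   | refl , adj-z with z Fin.≟ w
    ...     | yes refl = contradiction (trans (sym adj-z) (P5adj-irreflexive d z)) λ ()
    ...     | no z≢w with branch-degree≤d z≢w (i , j , refl , refl , m')
    ...       | inj₁ refl = contradiction refl z≢i
    ...       | inj₂ refl = inj₁ (i , j , refl , refl , uses-flip m')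

    exit-special : ∀ {x y z b} → UsesP x y (P z) (inj₁ b) → Special z
    exit-special {z = z} {b} (_ , _ , _ , _ , m) with attach-elim b c z (uses-adj m)
    ... | κ , e , _ = κ , e

    exit-unique : ∀ {x y x' y' z b b'} → UsesP x y (P z) (inj₁ b) → UsesP x' y' (P z) (inj₁ b') →
                  SamePair x y x' y'
    exit-unique {z = z} {b} {b'} u@(_ , _ , _ , _ , m) u'@(_ , _ , _ , _ , m')
      with attach-elim b c z (uses-adj m) | attach-elim b' c z (uses-adj m')
    ... | κ , refl , refl | κ' , e , refl with refl ← special-injective {κ = κ} {κ'} e = usesP-unique u u'

    -- Both removed edges ab and a'b must be rerouted through w, since a and a' are plain,
    -- and only one of the two routes can use the edge wb.
    path-needs-exit : ∀ a b a' → a ≢ w → b ≢ w → a' ≢ w → a ≢ b → a' ≢ b → a ≢ a' →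
      ¬ Special a → ¬ Special a' → P5adj d a b ≡ false → P5adj d a' b ≡ false →
      ∃ λ x → ¬ Special x × Out x b
    path-needs-exit a b a' a≢w b≢w a'≢w a≢b a'≢b a≢a' plain plain' na na'
      with leave a b a≢w b≢w a≢b na | leave a' b a'≢w b≢w a'≢b na'
    ... | inj₂ (_ , m) | _             = contradiction (exit-special m) plain
    ... | inj₁ _       | inj₂ (_ , m') = contradiction (exit-special m') plain'
    ... | inj₁ m       | inj₁ m' with through m | through m'
    ...   | inj₂ o | _       = a , plain , o
    ...   | inj₁ _ | inj₂ o' = a' , plain' , o'
    ...   | inj₁ u | inj₁ u' with usesP-unique u u'
    ...     | inj₁ (a≡a' , _) = contradiction a≡a' a≢a'
    ...     | inj₂ (a≡b , _)  = contradiction a≡b a≢b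

    -- Without the exit of w, each of the three routes runs either through w or outside the copy;
    -- two routes with a common end are of different types, but there are only two types.
    triangle-needs-exit : ∀ x y z → x ≢ w → y ≢ w → z ≢ w → x ≢ y → y ≢ z → z ≢ x →
      P5adj d x y ≡ false → P5adj d y z ≡ false → P5adj d z x ≡ false →
      ¬ Out x y → ¬ Out y z → ¬ Out z x → ⊥
    triangle-needs-exit x y z x≢w y≢w z≢w x≢y y≢z z≢x nxy nyz nzx ¬oxy ¬oyz ¬ozx =
      cycle (leave x y x≢w y≢w x≢y nxy)
      where
      Via : Fin (9 + k) → Fin (9 + k) → Set
      Via x y = UsesP x y (P x) (P w)
      Around : Fin (9 + k) → Fin (9 + k) → Set
      Around x y = ∃ λ b → UsesP x y (P x) (inj₁ b)
      via-sym : ∀ {x y} → ¬ Out x y → Via x y → Via y x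
      via-sym ¬o v with through v
      ... | inj₁ v' = usesP-swap v'
      ... | inj₂ o  = contradiction o ¬o
      out-sym : ∀ {x y} → ¬ Out x y → ¬ Out y x
      out-sym ¬o (b , m) = ¬o (b , usesP-swap m)
      leave' : ∀ x y → x ≢ w → y ≢ w → y ≢ x → P5adj d y x ≡ false → Via x y ⊎ Around x y
      leave' x y x≢w y≢w y≢x n = leave x y x≢w y≢w (≢-sym y≢x) (trans (P5adj-sym d x y) n)
      distinct : ∀ {x y z} → x ≢ y → y ≢ z → ¬ SamePair x y x z
      distinct x≢y y≢z (inj₁ (_ , e)) = y≢z e
      distinct x≢y y≢z (inj₂ (_ , e)) = x≢y (sym e)
      one-via : ∀ {x y z} → x ≢ y → y ≢ z → Via x y → ¬ Via x z
      one-via x≢y y≢z v v' = distinct x≢y y≢z (usesP-unique v v')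
      one-around : ∀ {x y z} → x ≢ y → y ≢ z → Around x y → ¬ Around x z
      one-around x≢y y≢z (_ , a) (_ , a') = distinct x≢y y≢z (exit-unique a a')
      around⇒via : ∀ {x y z} → x ≢ y → y ≢ z → Around x y → Via x z ⊎ Around x z → Via x z
      around⇒via _ _ _ (inj₁ v) = v
      around⇒via x≢y y≢z a (inj₂ a') = contradiction a' (one-around x≢y y≢z a)
      via⇒around : ∀ {x y z} → x ≢ y → y ≢ z → Via x y → Via x z ⊎ Around x z → Around x z
      via⇒around _ _ _ (inj₂ a) = a
      via⇒around x≢y y≢z v (inj₁ v') = contradiction v' (one-via x≢y y≢z v)
      cycle : Via x y ⊎ Around x y → ⊥
      -- The type alternates at `y` and at `z`, which makes the route to `z` leave `x` through `w`
      -- as well.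
      cycle (inj₁ vxy) = one-via x≢y y≢z vxy vxz
        where
        vyx : Via y x
        vyx = via-sym ¬oxy vxy
        ayz : Around y z
        ayz = via⇒around (≢-sym x≢y) (≢-sym z≢x) vyx (leave y z y≢w z≢w y≢z nyz)
        azy : Around z y
        -- Being around is not evidently symmetric, so the end at `z` is treated anew: a route
        -- through `w` from there would also reach `y` through `w`, against `vyx`.
        azy with leave' z y z≢w y≢w y≢z nyz
        ... | inj₂ a = a
        ... | inj₁ v = contradiction (via-sym (out-sym ¬oyz) v) (one-via (≢-sym x≢y) (≢-sym z≢x) vyx)
        vzx : Via z x
        vzx = around⇒via (≢-sym y≢z) (≢-sym x≢y) azy (leave z x z≢w x≢w z≢x nzx)
        vxz : Via x z
        vxz = via-sym ¬ozx vzx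
      -- The same alternation in the opposite direction, from `x` to `z` to `y`.
      cycle (inj₂ axy) = one-via (≢-sym z≢x) (≢-sym y≢z) vxz (via-sym (out-sym ¬oxy) vyx)
        where
        vxz : Via x z
        vxz = around⇒via x≢y y≢z axy (leave' x z x≢w z≢w z≢x nzx)
        vzx : Via z x
        vzx = via-sym (out-sym ¬ozx) vxz
        azy : Around z y
        azy = via⇒around z≢x x≢y vzx (leave' z y z≢w y≢w y≢z nyz)
        ayz : Around y z
        ayz with leave y z y≢w z≢w y≢z nyz
        ... | inj₂ a = a
        ... | inj₁ v = contradiction (via-sym ¬oyz v) (one-via z≢x x≢y vzx)
        vyx : Via y x
        vyx = around⇒via y≢z z≢x ayz (leave' y x y≢w x≢w x≢y nxy)


    -- The exit of `w` is taken by a route with a plain end, whereas the triangle's routes have two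
    -- special ends.
    exit-blocks-triangle : ∀ {x y} → ¬ Special x → Out x y → # 6 ≢ w → # 7 ≢ w → # 8 ≢ w → ⊥
    exit-blocks-triangle {x} {y} x-plain (b , m) 6≢w 7≢w 8≢w =
      triangle-needs-exit (# 6) (# 7) (# 8) 6≢w 7≢w 8≢w (λ ()) (λ ()) (λ ()) refl refl refl
        (blocked (suc (suc zero)) (suc (suc (suc zero))))
        (blocked (suc (suc (suc zero))) (suc (suc (suc (suc zero)))))
        (blocked (suc (suc (suc (suc zero)))) (suc (suc zero)))
      where
      blocked : ∀ κ κ' → ¬ Out (special κ) (special κ')
      blocked κ κ' (b' , m') with exit-unique m m'
      ... | inj₁ (e , _) = x-plain (κ , e)
      ... | inj₂ (e , _) = x-plain (κ' , e)

    plain : ∀ x {_ : False (special? {k} x)} → ¬ Special x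
    plain x {¬s} = toWitnessFalse ¬s

    exit-012 : # 0 ≢ w → # 1 ≢ w → # 2 ≢ w → ∃ λ x → ¬ Special x × Out x (# 1)
    exit-012 0≢w 1≢w 2≢w = path-needs-exit (# 0) (# 1) (# 2) 0≢w 1≢w 2≢w (λ ()) (λ ()) (λ ())
      (plain (# 0)) (plain (# 2)) refl refl

    exit-345 : # 3 ≢ w → # 4 ≢ w → # 5 ≢ w → ∃ λ x → ¬ Special x × Out x (# 4)
    exit-345 3≢w 4≢w 5≢w = path-needs-exit (# 3) (# 4) (# 5) 3≢w 4≢w 5≢w (λ ()) (λ ()) (λ ())
      (plain (# 3)) (plain (# 5)) refl refl

    contradictory : ⊥
    contradictory = go w refl
      where
      away : ∀ {x v} → w ≡ v → x ≢ v → x ≢ w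
      away w≡v x≢v x≡w = x≢v (trans x≡w w≡v)
      no-exit : ∀ {v y} → w ≡ v → ¬ Special v → ¬ ∃ λ x → ¬ Special x × Out x y
      no-exit refl v-plain (_ , _ , _ , m) = v-plain (exit-special m)
      from-012 : ∀ {v} → w ≡ v → # 0 ≢ v → # 1 ≢ v → # 2 ≢ v → ∃ λ x → ¬ Special x × Out x (# 1)
      from-012 w≡v 0≢v 1≢v 2≢v = exit-012 (away w≡v 0≢v) (away w≡v 1≢v) (away w≡v 2≢v)
      from-345 : ∀ {v} → w ≡ v → # 3 ≢ v → # 4 ≢ v → # 5 ≢ v → ∃ λ x → ¬ Special x × Out x (# 4)
      from-345 w≡v 3≢v 4≢v 5≢v = exit-345 (away w≡v 3≢v) (away w≡v 4≢v) (away w≡v 5≢v)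
      triangle : ∀ {v y} → w ≡ v → # 6 ≢ v → # 7 ≢ v → # 8 ≢ v → ¬ ∃ λ x → ¬ Special x × Out x y
      triangle w≡v 6≢v 7≢v 8≢v (_ , x-plain , o) =
        exit-blocks-triangle x-plain o (away w≡v 6≢v) (away w≡v 7≢v) (away w≡v 8≢v)
      two-exits : (∃ λ x → ¬ Special x × Out x (# 1)) → (∃ λ x → ¬ Special x × Out x (# 4)) → ⊥
      two-exits (_ , _ , _ , m) (_ , x'-plain , _ , m') with exit-unique m m'
      ... | inj₁ (_ , ())
      ... | inj₂ (_ , e) = x'-plain (zero , sym e)
      go : ∀ v → w ≡ v → ⊥
      go zero e = no-exit e (plain (# 0)) (from-345 e (λ ()) (λ ()) (λ ()))
      go (suc zero) e = triangle e (λ ()) (λ ()) (λ ()) (from-345 e (λ ()) (λ ()) (λ ()))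
      go (suc (suc zero)) e = no-exit e (plain (# 2)) (from-345 e (λ ()) (λ ()) (λ ()))
      go (suc (suc (suc zero))) e = no-exit e (plain (# 3)) (from-012 e (λ ()) (λ ()) (λ ()))
      go (suc (suc (suc (suc zero)))) e = triangle e (λ ()) (λ ()) (λ ()) (from-012 e (λ ()) (λ ()) (λ ()))
      go (suc (suc (suc (suc (suc zero))))) e = no-exit e (plain (# 5)) (from-012 e (λ ()) (λ ()) (λ ()))
      -- From 6 on, `w` avoids both removed paths, and each of them claims its exit.
      go (suc (suc (suc (suc (suc (suc v)))))) e =
        two-exits (from-012 e (λ ()) (λ ()) (λ ())) (from-345 e (λ ()) (λ ()) (λ ()))

  -- Cuts around intervals of bays.

  -- A copy is counted with the bay it is attached to, so only links join different bays.
  bay : V → Fin n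
  bay (inj₁ (i , _)) = i
  bay (inj₂ (c , _)) = β c

  Within : Fin n → Fin n → Fin n → Set
  Within l e i = toℕ l ≤ toℕ i × toℕ i ≤ toℕ e

  within? : ∀ l e → Decidable (Within l e)
  within? l e i = (toℕ l ℕ.≤? toℕ i) ×-dec (toℕ i ℕ.≤? toℕ e)

  -- Intervals are linear although the bays are cyclic: the wrapping link starts at bay 0, which can
  -- only be the lower end.
  exit-below : ∀ {l e i i'} → PredMod i i' → Within l e i → ¬ Within l e i' → i ≡ l
  exit-below (inj₂ (i≡0 , _)) (l≤i , _) _ = Finₚ.toℕ-injective
    (trans i≡0 (sym (ℕₚ.n≤0⇒n≡0 (ℕₚ.≤-trans l≤i (ℕₚ.≤-reflexive i≡0)))))
  exit-below {l} {e} {i} (inj₁ i≡1+i') (l≤i , i≤e) out with ℕₚ.m≤n⇒m<n∨m≡n l≤i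
  ... | inj₂ l≡i = Finₚ.toℕ-injective (sym l≡i)
  ... | inj₁ l<i = contradiction
    (ℕ.s≤s⁻¹ (subst (toℕ l ℕ.<_) (sym i≡1+i') l<i) , ℕₚ.<⇒≤ (subst (ℕ._≤ toℕ e) (sym i≡1+i') i≤e)) out

  exit-above : ∀ {l e i i'} → PredMod i' i → Within l e i → ¬ Within l e i' → i ≡ e
  exit-above {e = e} (inj₂ (_ , 1+i≡n)) (_ , i≤e) _ = Finₚ.toℕ-injective
    (ℕₚ.≤-antisym i≤e (ℕ.s≤s⁻¹ (subst (toℕ e ℕ.<_) (sym 1+i≡n) (Finₚ.toℕ<n e))))
  exit-above {l} {e} (inj₁ 1+i≡i') (l≤i , i≤e) out with ℕₚ.m≤n⇒m<n∨m≡n i≤e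
  ... | inj₂ i≡e = Finₚ.toℕ-injective i≡e
  ... | inj₁ i<e = contradiction
    (subst (toℕ l ≤_) 1+i≡i' (ℕₚ.m≤n⇒m≤1+n l≤i) , subst (_≤ toℕ e) 1+i≡i' i<e) out

  adj-across : ∀ u v → Adj u v → bay u ≡ bay v ⊎
               ∃₂ λ a b → u ≡ inj₁ a × v ≡ inj₁ b × (Linked a b ⊎ Linked b a)
  adj-across (inj₁ a) (inj₁ b) e with bay-adj a b e
  ... | inj₁ eq = inj₁ eq
  ... | inj₂ l  = inj₂ (a , b , refl , refl , l)
  adj-across (inj₁ b) (inj₂ (c , x)) e with attach-elim b c x e
  ... | _ , _ , refl = inj₁ refl
  adj-across (inj₂ (c , x)) (inj₁ b) e with attach-elim b c x e
  ... | _ , _ , refl = inj₁ refl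
  adj-across (inj₂ (c , x)) (inj₂ (c' , y)) e with copy-adj c x c' y e
  ... | refl , _ = inj₁ refl

  -- The label is the side of the interval together with the position of the link's end in the later
  -- bay, which lies in the first half and determines the link.
  data Boundary (l e : Fin n) : Fin ⌈ 6 + k /2⌉ ⊎ Fin ⌈ 6 + k /2⌉ → V → V → Set where
    below : ∀ {p b s} → toℕ p ≡ toℕ s → Linked (l , p) b →
            Boundary l e (inj₁ s) (inj₁ (l , p)) (inj₁ b)
    above : ∀ {p i q s} → toℕ q ≡ toℕ s → Linked (i , q) (e , p) →
            Boundary l e (inj₂ s) (inj₁ (e , p)) (inj₁ (i , q))

  boundary-functional : ∀ {l e s u v u' v'} → Boundary l e s u v → Boundary l e s u' v' →
                        u ≡ u' × v ≡ v'
  boundary-functional (below eq ln) (below eq' ln')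
    with refl ← Finₚ.toℕ-injective (trans eq (sym eq')) = refl , cong inj₁ (linked-functional ln ln')
  boundary-functional (above eq ln) (above eq' ln')
    with refl ← Finₚ.toℕ-injective (trans eq (sym eq'))
    with refl ← predMod-injective (proj₁ ln) (proj₁ ln') =
    cong inj₁ (linked-functional ln ln') , refl

  boundary-cover : ∀ {l e u v} → Within l e (bay u) → ¬ Within l e (bay v) → Adj u v →
                   ∃ λ s → Boundary l e s u v
  boundary-cover {l} {e} {u} {v} u-in v-out uv with adj-across u v uv
  ... | inj₁ eq = contradiction (subst (Within l e) eq u-in) v-out
  ... | inj₂ (_ , _ , refl , refl , inj₁ ln@(pm , p<h , _)) with refl ← exit-below {l} {e} pm u-in v-out =
    inj₁ (Fin.fromℕ< p<h) , below (sym (Finₚ.toℕ-fromℕ< p<h)) ln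
  ... | inj₂ (_ , _ , refl , refl , inj₂ ln@(pm , q<h , _)) with refl ← exit-above {l} {e} pm u-in v-out =
    inj₂ (Fin.fromℕ< q<h) , above (sym (Finₚ.toℕ-fromℕ< q<h)) ln

  -- For odd d there are exactly d - 1 labels, so the d pairs of `not-two-and-two` are just enough.
  few-boundary-edges : ⌈ 6 + k /2⌉ + ⌈ 6 + k /2⌉ ℕ.< d
  few-boundary-edges = s≤s (ℕₚ.≤-trans (ℕₚ.+-monoˡ-≤ ⌈ 6 + k /2⌉ (⌈n/2⌉≤1+⌊n/2⌋ (6 + k)))
    (ℕₚ.≤-reflexive (cong suc (ℕₚ.⌊n/2⌋+⌈n/2⌉≡n (6 + k)))))
    where
    ⌈n/2⌉≤1+⌊n/2⌋ : ∀ n → ⌈ n /2⌉ ≤ suc ⌊ n /2⌋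
    ⌈n/2⌉≤1+⌊n/2⌋ n = ℕₚ.⌊n/2⌋-mono (ℕₚ.n≤1+n (suc n))

  interval-undivided : ∀ l e {a a' b b'} → a ≢ a' → b ≢ b' →
    Within l e (bay (φ a)) → Within l e (bay (φ a')) →
    ¬ Within l e (bay (φ b)) → ¬ Within l e (bay (φ b')) → ⊥
  interval-undivided l e = not-two-and-two few-boundary-edges
    where
    h : ℕ
    h = ⌈ 6 + k /2⌉
    cover : ∀ {u v} → Within l e (bay u) → ¬ Within l e (bay v) → Adj u v →
            ∃ λ κ → Boundary l e (Fin.splitAt h κ) u v
    cover {u} {v} u-in v-out uv with boundary-cover {l} {e} {u} {v} u-in v-out uv
    ... | s , bd = Fin.join h h s , subst (λ s → Boundary l e s u v) (sym (Finₚ.splitAt-join h h s)) bd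
    open Cut (within? l e ∘ bay) (λ κ → Boundary l e (Fin.splitAt h κ)) boundary-functional
      (λ {u} {v} → cover {u} {v})

  Two : (Fin d → Set) → Set
  Two Q = ∃₂ λ a b → a ≢ b × Q a × Q b

  two? : ∀ {Q} → Decidable Q → Dec (Two Q)
  two? Q? = Finₚ.any? λ a → Finₚ.any? λ b → ¬? (a Fin.≟ b) ×-dec (Q? a ×-dec Q? b)

  -- All branch vertices in bays.

  module InBays (place : Fin d → BayV d n) (φ≡ : ∀ i → φ i ≡ inj₁ (place i)) where

    level : Fin d → ℕ
    level a = toℕ (bay (φ a))

    UpTo : Fin n → Fin d → Set
    UpTo e a = level a ≤ toℕ e

    two-upTo? : ∀ e → Dec (Two (UpTo e))
    two-upTo? e = two? λ a → level a ℕ.≤? toℕ e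

    two-upTo-max : ∀ {a b} → a ≢ b → Two (UpTo (bay (φ a))) ⊎ Two (UpTo (bay (φ b)))
    two-upTo-max {a} {b} a≢b with ℕₚ.≤-total (level a) (level b)
    ... | inj₁ a≤b = inj₂ (a , b , a≢b , a≤b , ℕₚ.≤-refl)
    ... | inj₂ b≤a = inj₁ (a , b , a≢b , ℕₚ.≤-refl , b≤a)

    least : ∃ λ e → Two (UpTo e) × (∀ e' → toℕ e' ℕ.< toℕ e → ¬ Two (UpTo e'))
    least with Finₚ.¬∀⟶∃¬-smallest n (λ e → ¬ Two (UpTo e)) (¬? ∘ two-upTo?)
                 -- Branch vertices 0 and 1 show that some bay qualifies.
                 (λ none → [ none _ , none _ ]′ (two-upTo-max {zero} {suc zero} λ ()))
    ... | e , ¬¬two , below-e = e , decidable-stable (two-upTo? e) ¬¬two , λ e' e'<e →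
      subst (λ e → ¬ Two (UpTo e))
        (Finₚ.toℕ-injective (trans (Finₚ.toℕ-inject (Fin.fromℕ< e'<e)) (Finₚ.toℕ-fromℕ< e'<e)))
        (below-e (Fin.fromℕ< e'<e))

    -- Otherwise at least d - 1 branch vertices share a bay of d - 2 vertices. The double negation
    -- suffices for deriving absurdity.
    some-two-elsewhere : ∀ e → ¬ ¬ Two (λ a → bay (φ a) ≢ e)
    some-two-elsewhere e few = clash (Finₚ.pigeonhole (ℕₚ.n<1+n (6 + k)) slot)
      where
      exception : ∃ λ b → ∀ a → a ≢ b → bay (φ a) ≡ e
      exception with Finₚ.any? (λ b → ¬? (bay (φ b) Fin.≟ e))
      ... | yes (b , b≢e) = b , λ a a≢b → decidable-stable (bay (φ a) Fin.≟ e) λ a≢e →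
        few (a , b , a≢b , a≢e , b≢e)
      -- With no branch vertex outside bay `e`, the exception is arbitrary.
      ... | no none = zero , λ a _ → decidable-stable (bay (φ a) Fin.≟ e) λ a≢e → none (a , a≢e)
      b : Fin d
      b = proj₁ exception
      crowded : ∀ x → proj₁ (place (punchIn b x)) ≡ e
      crowded x = trans (sym (cong bay (φ≡ (punchIn b x))))
        (proj₂ exception (punchIn b x) (Finₚ.punchInᵢ≢i b x))
      slot : Fin (7 + k) → Fin (6 + k)
      slot x = proj₂ (place (punchIn b x))
      slot-injective : ∀ x y → slot x ≡ slot y → x ≡ y
      slot-injective x y eq = Finₚ.punchIn-injective b x y (φ-inj _ _ (trans (φ≡ _)
        (trans (cong inj₁ (cong₂ _,_ (trans (crowded x) (sym (crowded y))) eq)) (sym (φ≡ _)))))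
      clash : (∃₂ λ x y → x < y × slot x ≡ slot y) → ⊥
      clash (x , y , x<y , eq) = Finₚ.<⇒≢ x<y (slot-injective x y eq)

    three-classes : ∀ e → Two (λ a → level a ℕ.< toℕ e) ⊎
                          (Two (λ a → bay (φ a) ≡ e) ⊎ Two (λ a → toℕ e ℕ.< level a))
    three-classes e = same-class (Finₚ.pigeonhole (ℕₚ.m≤m+n 4 (4 + k)) class)
      where
      class : Fin d → Fin 3
      class a with Finₚ.<-cmp (bay (φ a)) e
      ... | tri< _ _ _ = # 0
      ... | tri≈ _ _ _ = # 1
      ... | tri> _ _ _ = # 2
      same-class : (∃₂ λ a b → a < b × class a ≡ class b) → _
      same-class (a , b , a<b , eq) with Finₚ.<-cmp (bay (φ a)) e | Finₚ.<-cmp (bay (φ b)) e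
      ... | tri< x _ _ | tri< y _ _ = inj₁ (a , b , Finₚ.<⇒≢ a<b , x , y)
      ... | tri≈ _ x _ | tri≈ _ y _ = inj₂ (inj₁ (a , b , Finₚ.<⇒≢ a<b , x , y))
      ... | tri> _ _ x | tri> _ _ y = inj₂ (inj₂ (a , b , Finₚ.<⇒≢ a<b , x , y))

    -- Take the first bay e up to which there are two branch vertices. The interval of bays 0..e
    -- leaves at most one above it, so bay e contains two; then at most one lies outside bay e.
    contradictory : ⊥
    contradictory = split-at least
      where
      first : ∀ {n} → Fin n → ∃ λ (z : Fin n) → ∀ (i : Fin n) → toℕ z ≤ toℕ i
      first {suc _} _ = zero , λ _ → z≤n
      no-two-above : ∀ e → Two (UpTo e) → ¬ Two (λ a → toℕ e ℕ.< level a)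
      no-two-above e (a , a' , a≢a' , a≤e , a'≤e) (b , b' , b≢b' , e<b , e<b') with first e
      ... | z , z≤ = interval-undivided z e a≢a' b≢b'
        (z≤ _ , a≤e) (z≤ _ , a'≤e) (ℕₚ.<⇒≱ e<b ∘ proj₂) (ℕₚ.<⇒≱ e<b' ∘ proj₂)
      no-two-within : ∀ e → ¬ Two (λ a → bay (φ a) ≡ e)
      no-two-within e (b , b' , b≢b' , b≡e , b'≡e) = some-two-elsewhere e λ (c , c' , c≢c' , c≢e , c'≢e) →
        interval-undivided e e b≢b' c≢c' (in-e b≡e) (in-e b'≡e) (c≢e ∘ only-e) (c'≢e ∘ only-e)
        where
        in-e : ∀ {i} → i ≡ e → Within e e i
        in-e refl = ℕₚ.≤-refl , ℕₚ.≤-refl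
        only-e : ∀ {i} → Within e e i → i ≡ e
        only-e (e≤i , i≤e) = Finₚ.toℕ-injective (ℕₚ.≤-antisym i≤e e≤i)
      split-at : (∃ λ e → Two (UpTo e) × (∀ e' → toℕ e' ℕ.< toℕ e → ¬ Two (UpTo e'))) → ⊥
      split-at (e , two , minimal) =
        [ no-two-below , [ no-two-within e , no-two-above e two ]′ ]′ (three-classes e)
        where
        no-two-below : ¬ Two (λ a → level a ℕ.< toℕ e)
        no-two-below (b , b' , b≢b' , b<e , b'<e) =
          [ minimal _ b<e , minimal _ b'<e ]′ (two-upTo-max b≢b')

  impossible : ⊥
  -- One branch vertex decides the case: `copy-undivided` forces all others into the same copy, or
  -- all into bays.
  impossible with φ zero in eq
  ... | inj₂ (c , x) = InOneCopy.contradictory c (proj₁ ∘ all) (proj₂ ∘ all)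
                         (proj₁ missed) (proj₁ (proj₂ missed)) (proj₂ (proj₂ missed))
    where
    all : ∀ i → InCopy c (φ i)
    all i = decidable-stable (inCopy? c (φ i)) (copy-undivided c (x , eq))
    missed : _
    missed = missed-vertex (proj₁ ∘ all) λ i j e →
      φ-inj i j (trans (proj₂ (all i)) (trans (cong (inj₂ ∘ (c ,_)) e) (sym (proj₂ (all j)))))
  ... | inj₁ b = InBays.contradictory (proj₁ ∘ all) (proj₂ ∘ all)
    where
    all : ∀ i → ∃ λ a → φ i ≡ inj₁ a
    all i with φ i in eqᵢ
    ... | inj₁ a       = a , refl
    ... | inj₂ (c , y) = ⊥-elim (copy-undivided c {i} {zero} (y , eqᵢ)
      λ (z , e) → contradiction (trans (sym eq) e) λ ())

-- Minimum degree and absence of an immersion combined.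

theorem4p17 : (d n m : ℕ) → 8 ≤ d → 1 ≤ n →
    (β : Fin m → Fin n) (t : Fin m → Fin 5 → Fin (d ∸ 2)) →
    (∀ (b : BayV d n) → d ∸ 1 ≤ Hdeg d n m β t (inj₁ b)) →
    ((∀ v → d ∸ 1 ≤ Hdeg d n m β t v) × (∃ λ v → Hdeg d n m β t v ≡ d ∸ 1))
    × ¬ HImmersesK d n m β t d
theorem4p17 _ n m (s≤s (s≤s (s≤s (s≤s (s≤s (s≤s (s≤s (s≤s (z≤n {k}))))))))) (s≤s _) β t bay-degree =
  (minimum-degree , attained m β t bay-degree) , NoImmersion.impossible k n m β t
  where
  minimum-degree : ∀ v → 7 + k ≤ Hdeg (8 + k) n m β t v
  minimum-degree (inj₁ b)       = bay-degree b
  minimum-degree (inj₂ (c , x)) = Host.copy-degree k n m β t c x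
  attained : ∀ m (β : Fin m → Fin n) t → (∀ b → 7 + k ≤ Hdeg (8 + k) n m β t (inj₁ b)) →
             ∃ λ v → Hdeg (8 + k) n m β t v ≡ 7 + k
  attained (suc m) β t _ = inj₂ (zero , zero) , Host.copy-degree-zero k n (suc m) β t zero
  -- Without copies the first vertex of bay 0 would violate the degree hypothesis.
  attained zero β t bay-degree = contradiction
    (ℕₚ.≤-trans (bay-degree (zero , zero)) (Host.bay-degree-without-copies k n zero β t (λ ()) zero))
    (ℕₚ.<⇒≱ ℕₚ.≤-refl)
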